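{- Let $T=\{2143,2431,3241\}$. Then $$F_T(x)=\frac{1-5x+7x^2-4x^3}{1-6x+11x^2-9x^3+2x^4}.$$
   Context: $S_n(T)$ denotes the set of permutations $\pi$ of $[n]=\{1,\dots,n\}$ (one-line notation) that avoid every pattern $\tau\in T$, i.e. no subsequence of $\pi$ is order-isomorphic to $\tau$. $F_T(x)=\sum_{n\ge 0}|S_n(T)|x^n$, a formal power series, with $|S_0(T)|=1$. -}

module Defs where

open import Data.Fin.Base using (Fin; _<_)
open import Data.Fin.Patterns using (0F; 1F; 2F; 3F)
open import Data.Fin.Properties as Fin using (_<?_; all?; any?)
open import Data.Integer.Base as ℤ using (ℤ; +_; 0ℤ; 1ℤ)
import Data.Integer.Properties as ℤ
open import Data.Integer.Tactic.RingSolver using (solve-∀)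
open import Data.List.Base
  using (List; []; _∷_; allFin; cartesianProductWith; filter; length)
open import Data.List.Membership.Propositional using (_∈_; find; lose)
open import Data.List.Membership.Propositional.Properties
  using (∈-allFin; ∈-cartesianProductWith⁺)
open import Data.List.Relation.Unary.All as All using (All)
open import Data.List.Relation.Unary.AllPairs using ([]; _∷_)
import Data.List.Relation.Unary.Any as Any
open import Data.List.Relation.Unary.Unique.Propositional using (Unique)
open import Data.List.Relation.Unary.Unique.Propositional.Properties
  using (allFin⁺; cartesianProductWith⁺)
open import Data.Nat.Base using (ℕ; zero; suc)
open import Data.Product.Base using (_×_; _,_; ∃-syntax)
open import Data.Vec.Base as Vec using (Vec; []; _∷_; lookup)
open import Data.Vec.Properties using (∷-injective)
import Data.Vec.Relation.Unary.AllPairs as VecPairs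
open import Function.Base using (_∘_)
open import Function.Bundles using (_⇔_; mk⇔; Equivalence)
open import Function.Definitions using (Bijective)
open import Relation.Binary.PropositionalEquality
  using (_≡_; _≗_; refl; sym; trans; cong; cong₂)
open import Relation.Nullary.Decidable
  using (Dec; True; toWitness; map′; ¬?; _×-dec_; _→-dec_)
open import Relation.Nullary.Negation using (¬_)

-- One-line notation; the letters are 0, …, n − 1 instead of 1, …, n.
Word : ℕ → ℕ → Set
Word k n = Vec (Fin n) k

IsPermutation : ∀ {n} → Word n n → Set
IsPermutation π = Bijective _≡_ _≡_ (lookup π)

words : ∀ k n → List (Word k n)
words zero    n = [] ∷ []
words (suc k) n = cartesianProductWith _∷_ (allFin n) (words k n)

words-complete : ∀ {k n} (w : Word k n) → w ∈ words k n
words-complete []      = Any.here refl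
words-complete (i ∷ w) =
  ∈-cartesianProductWith⁺ _∷_ (∈-allFin i) (words-complete w)

words-unique : ∀ k n → Unique (words k n)
words-unique zero    n = All.[] ∷ []
words-unique (suc k) n =
  cartesianProductWith⁺ _∷_ ∷-injective (allFin⁺ n) (words-unique k n)

isPermutation? : ∀ {n} (π : Word n n) → Dec (IsPermutation π)
isPermutation? π = injective? ×-dec surjective?
  where
  injective? = map′ (λ inj {i} {j} → inj i j) (λ inj i j → inj {i} {j})
    (all? λ i → all? λ j → (lookup π i Fin.≟ lookup π j) →-dec (i Fin.≟ j))
  surjective? = all? λ j → map′
    (λ (i , eq) → i , λ { refl → eq })
    (λ (i , eq) → i , eq refl)
    (any? λ i → lookup π i Fin.≟ j)

OrderIsomorphic : ∀ {k m n} → Word k m → Word k n → Set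
OrderIsomorphic u v =
  ∀ i j → (lookup u i < lookup u j) ⇔ (lookup v i < lookup v j)

Increasing : ∀ {k n} → Word k n → Set
Increasing = VecPairs.AllPairs _<_

-- ι lists the positions of the subsequence of π.
Contains : ∀ {k n} → Word n n → Word k k → Set
Contains {k} {n} π τ =
  ∃[ ι ] Increasing {k} {n} ι × OrderIsomorphic (Vec.map (lookup π) ι) τ

Pattern : Set
Pattern = ∃[ k ] Word k k

Avoids : ∀ {n} → Word n n → Pattern → Set
Avoids π (_ , τ) = ¬ Contains π τ

orderIsomorphic? : ∀ {k m n} (u : Word k m) (v : Word k n) →
                   Dec (OrderIsomorphic u v)
orderIsomorphic? u v = all? λ i → all? λ j →
  let p? = lookup u i <? lookup u j
      q? = lookup v i <? lookup v j
  in map′ (λ (f , g) → mk⇔ f g)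
          (λ e → Equivalence.to e , Equivalence.from e)
          ((p? →-dec q?) ×-dec (q? →-dec p?))

contains? : ∀ {k n} (π : Word n n) (τ : Word k k) → Dec (Contains π τ)
contains? {k} {n} π τ = map′
  (λ p → let (ι , _ , q) = find p in ι , q)
  (λ (ι , q) → lose (words-complete ι) q)
  (Any.any? (λ ι → VecPairs.allPairs? _<?_ ι
                   ×-dec orderIsomorphic? (Vec.map (lookup π) ι) τ)
            (words k n))

avoids? : ∀ {n} (π : Word n n) (τ : Pattern) → Dec (Avoids π τ)
avoids? π (_ , τ) = ¬? (contains? π τ)

S : ∀ n → List Pattern → List (Word n n)
S n T = filter (λ π → isPermutation? π ×-dec All.all? (avoids? π) T)
               (words n n)

-- Formal power series over ℤ, as coefficient sequences.
Series : Set
Series = ℕ → ℤ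

poly : List ℤ → Series
poly []       n       = 0ℤ
poly (c ∷ cs) zero    = c
poly (c ∷ cs) (suc n) = poly cs n

infixl 7 _*_ _/_

-- Cauchy product, from A = A₀ + x A′.
_*_ : Series → Series → Series
(A * B) zero    = A 0 ℤ.* B 0
(A * B) (suc n) = A 0 ℤ.* B (suc n) ℤ.+ ((A ∘ suc) * B) n

-- Long division by a series with constant term 1: the quotient A / B has
-- constant term A₀, and its tail is (A − A₀ B) / x divided by B.
_/_ : (A B : Series) → {True (B 0 ℤ.≟ 1ℤ)} → Series
(A / B)       zero    = A 0
(A / B) {B₀} (suc n) =
  ((λ m → A (suc m) ℤ.- A 0 ℤ.* B (suc m)) / B) {B₀} n

/-* : ∀ A B {B₀ : True (B 0 ℤ.≟ 1ℤ)} → (A / B) {B₀} * B ≗ A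
/-* A B {B₀} zero = trans (cong (A 0 ℤ.*_) (toWitness B₀)) (ℤ.*-identityʳ (A 0))
/-* A B {B₀} (suc n) = trans (cong (λ z → A 0 ℤ.* B (suc n) ℤ.+ z) (/-* _ B {B₀} n))
                             (cancel (A 0 ℤ.* B (suc n)) (A (suc n)))
  where
  cancel : ∀ p a → p ℤ.+ (a ℤ.- p) ≡ a
  cancel = solve-∀

/-cong : ∀ {A A′} B {B₀ : True (B 0 ℤ.≟ 1ℤ)} → A ≗ A′ →
         (A / B) {B₀} ≗ (A′ / B) {B₀}
/-cong B A≗A′ zero = A≗A′ 0
/-cong B {B₀} A≗A′ (suc n) = /-cong B {B₀}
  (λ m → cong₂ (λ a a₀ → a ℤ.- a₀ ℤ.* B (suc m)) (A≗A′ (suc m)) (A≗A′ 0)) n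

/-unique : ∀ {A} B C {B₀ : True (B 0 ℤ.≟ 1ℤ)} →
           C * B ≗ A → C ≗ (A / B) {B₀}
/-unique {A} B C {B₀} eq n = trans (*-/ C n) (/-cong B {B₀} eq n)
  where
  head : ∀ C → (C * B) 0 ≡ C 0
  head C = trans (cong (C 0 ℤ.*_) (toWitness B₀)) (ℤ.*-identityʳ (C 0))

  cancel : ∀ p q → q ≡ (p ℤ.+ q) ℤ.- p
  cancel = solve-∀

  *-/ : ∀ C → C ≗ ((C * B) / B) {B₀}
  *-/ C zero    = sym (head C)
  *-/ C (suc n) = trans (*-/ (C ∘ suc) n) (/-cong B {B₀} tail n)
    where
    tail : ∀ m → ((C ∘ suc) * B) m ≡
                 (C * B) (suc m) ℤ.- (C * B) 0 ℤ.* B (suc m)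
    tail m = trans
      (cancel (C 0 ℤ.* B (suc m)) (((C ∘ suc) * B) m))
      (cong (λ c → (C * B) (suc m) ℤ.- c ℤ.* B (suc m)) (sym (head C)))

F : List Pattern → Series
F T n = + length (S n T)

-- 2143, 2431 and 3241, with every letter lowered by 1.
T : List Pattern
T = (4 , 1F ∷ 0F ∷ 3F ∷ 2F ∷ [])
  ∷ (4 , 1F ∷ 3F ∷ 2F ∷ 0F ∷ [])
  ∷ (4 , 2F ∷ 1F ∷ 3F ∷ 0F ∷ [])
  ∷ []

{-# OPTIONS --safe #-}
module Submission where

-- Write an avoider with maximum D as α D β with β nonempty (if β is empty, α is
-- an arbitrary avoider).  If α has a descent, avoiding 2143 and 3241 forces every
-- inversion of α to straddle all of β: then β is a block X of consecutive values
-- and α is an unsorted shuffle of the two increasing runs below and above X.  If α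
-- is increasing, avoiding 2431 and 2143 forces β = X γ, where X is a block of
-- consecutive values, all letters outside X are in increasing order on each side
-- of D, and those below X, as well as the least one above X, stand in α.  In both
-- cases X is an arbitrary nonempty avoider and the other k letters are described
-- by k bits, unsorted ones in the first case (2ᵏ − k − 1 choices) and arbitrary
-- ones in the second.  Hence
--   aₙ₊₁ = aₙ + Σ (2 · 2ᵏ − k − 1) aₘ   over k + m = n, m ≥ 1.

open import Defs
open import Data.Bool.Base using (Bool; true; false)
import Data.Bool.Properties as Bool
open import Data.Empty using (⊥)
open import Data.Fin.Base as Fin using (Fin; zero; suc; toℕ; fromℕ<)
open import Data.Fin.Patterns using (0F; 1F; 2F; 3F)
import Data.Fin.Properties as Fin
open import Data.List.Base hiding (lookup; find; [_]; sum)
open import Data.List.Membership.DecPropositional Bool._≟_ using (_∈?_)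
open import Data.List.Membership.Propositional using (_∈_; find)
open import Data.List.Membership.Propositional.Properties
open import Data.List.Membership.Propositional.Properties.WithK using (unique∧set⇒bag)
open import Data.List.Properties
  using (++-assoc; ++-identityʳ; ++-conicalˡ; ++-conicalʳ; length-++; length-map; length-iterate;
         ∷-injective; ∷-injectiveˡ; ∷-injectiveʳ; ∷ʳ-injectiveˡ;
         filter-++; filter-all; filter-none; filter-≐)
open import Data.List.Relation.Binary.BagAndSetEquality using (∼bag⇒↭)
open import Data.List.Relation.Binary.Permutation.Propositional hiding (trans)
open import Data.List.Relation.Binary.Permutation.Propositional.Properties
  hiding (++-assoc; ++-identityʳ)
import Data.List.Relation.Binary.Permutation.Setoid.Properties as Permutation
open import Data.List.Relation.Binary.Sublist.Propositional as Sub
  using (_⊆_; []; _∷_; ⊆-trans; ⊆-refl; minimum; to∈; from∈) renaming (_∷ʳ_ to skip)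
open import Data.List.Relation.Binary.Sublist.Propositional.Properties as Sub
  using (All-resp-⊆; ∷ˡ⁻; filter-⊆)
open import Data.List.Relation.Unary.All as All using (All; []; _∷_)
import Data.List.Relation.Unary.All.Properties as All
open import Data.List.Relation.Unary.AllPairs as AllPairs using (AllPairs; []; _∷_)
import Data.List.Relation.Unary.AllPairs.Properties as AllPairs
open import Data.List.Relation.Unary.Any as Any using (here; there)
open import Data.List.Relation.Unary.Unique.Propositional using (Unique)
import Data.List.Relation.Unary.Unique.Propositional.Properties as Unique
open import Data.Nat.Base as ℕ hiding (_*_; _/_)
open import Data.Nat.Properties
open import Data.Nat.Tactic.RingSolver using (solve-∀)
open import Data.Product.Base using (_×_; _,_; ∃-syntax; ∃₂; proj₁; proj₂)
open import Data.Product.Properties using (,-injectiveʳ)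
open import Data.Sum.Base using (_⊎_; inj₁; inj₂; [_,_])
open import Data.Unit.Base using (tt)
open import Data.Vec.Base as Vec using (Vec; []; _∷_; lookup; toList)
import Data.Vec.Properties as Vec
open import Data.Vec.Relation.Unary.All as VecAll using ([]; _∷_)
import Data.Vec.Relation.Unary.All.Properties as VecAll
open import Data.Vec.Relation.Unary.AllPairs as VecPairs using ([]; _∷_)
import Data.Vec.Relation.Unary.AllPairs.Properties as VecPairs
open import Data.Vec.Relation.Unary.Linked using (Linked; [-]; _∷_)
import Data.Vec.Relation.Unary.Linked.Properties as Linked
open import Function.Base using (_∘_)
open import Function.Bundles using (mk⇔; Equivalence)
open import Relation.Binary.Definitions using (tri<; tri≈; tri>)
import Relation.Binary.Definitions as Binary
open import Relation.Binary.PropositionalEquality hiding ([_])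
open import Relation.Nullary.Decidable
  using (yes; no; does; decidable-stable; True; toWitness; _×-dec_)
open import Relation.Nullary.Negation using (¬_; contradiction)
open import Relation.Unary using (Decidable)
open import Relation.Unary.Properties using (∁?; U?)

-- The converse direction, that every code yields an avoider, rests on two features shared by the
-- patterns. The first letter is neither the least nor the greatest of the four, so a letter whose
-- value lies outside the interval of X cannot begin an occurrence that continues inside X. The last
-- two letters descend, so an ascending tail above X is harmless. In the second case the least
-- letter above X is required in α to make the block unique: at the head of γ it could equally be
-- counted as the last letter of X. The weights 2 · 2ᵏ - k - 1 have generating function G = 2/(1-2x)
-- - 1/(1-x)² = (1-2x+2x²)/((1-2x)(1-x)²). The recurrence reads F - 1 = xF + x(F-1)G, and clearing
-- the denominator (1-2x)(1-x)² gives the claimed fraction. The proof reaches it through a linear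
-- system instead of through quotients of series.

-- Sublists and pairwise relations along lists

⊆-++⁻ : ∀ {A : Set} {zs : List A} xs {ys} → zs ⊆ xs ++ ys →
        ∃₂ λ us vs → zs ≡ us ++ vs × us ⊆ xs × vs ⊆ ys
⊆-++⁻ []       τ        = [] , _ , refl , [] , τ
⊆-++⁻ (x ∷ xs) (skip _ τ) =
  let us , vs , eq , σ , ρ = ⊆-++⁻ xs τ in us , vs , eq , skip x σ , ρ
⊆-++⁻ (x ∷ xs) (refl ∷ τ) =
  let us , vs , eq , σ , ρ = ⊆-++⁻ xs τ
  in x ∷ us , vs , cong (x ∷_) eq , refl ∷ σ , ρ

module _ {A : Set} {R : A → A → Set} where

  AllPairs-resp-⊆ : ∀ {xs ys} → xs ⊆ ys → AllPairs R ys → AllPairs R xs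
  AllPairs-resp-⊆ []         []       = []
  AllPairs-resp-⊆ (skip _ τ) (_ ∷ ps) = AllPairs-resp-⊆ τ ps
  AllPairs-resp-⊆ (refl ∷ τ) (p ∷ ps) = All-resp-⊆ τ p ∷ AllPairs-resp-⊆ τ ps

  AllPairs-lookup : ∀ {x y xs} → AllPairs R xs → x ∷ y ∷ [] ⊆ xs → R x y
  AllPairs-lookup ps τ with (r ∷ []) ∷ _ ← AllPairs-resp-⊆ τ ps = r

  AllPairs-tabulate : ∀ {xs} → (∀ {x y} → x ∷ y ∷ [] ⊆ xs → R x y) →
                      AllPairs R xs
  AllPairs-tabulate {[]}     f = []
  AllPairs-tabulate {x ∷ xs} f =
    All.tabulate (λ y∈ → f (refl ∷ from∈ y∈)) ∷ AllPairs-tabulate (λ τ → f (skip x τ))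

-- Forbidden patterns in lists of numbers

Ascending : List ℕ → Set
Ascending = AllPairs _<_

-- Each constructor holds the three comparisons between letters adjacent in value, which fix the
-- order type of the four letters.
data Forbidden (p q r s : ℕ) : Set where
  like-2143 : q < p → p < s → s < r → Forbidden p q r s
  like-2431 : s < p → p < r → r < q → Forbidden p q r s
  like-3241 : s < q → q < p → p < r → Forbidden p q r s

Avoiding : List ℕ → Set
Avoiding π = ∀ {p q r s} → p ∷ q ∷ r ∷ s ∷ [] ⊆ π → ¬ Forbidden p q r s

avoiding-⊆ : ∀ {σ π} → σ ⊆ π → Avoiding π → Avoiding σ
avoiding-⊆ τ av σ = av (⊆-trans σ τ)

-- All three patterns end in a descent, so an ascending tail of a word never supplies their last two
-- letters.
last<third : ∀ {p q r s} → Forbidden p q r s → s < r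
last<third (like-2143 _ _ s<r)     = s<r
last<third (like-2431 s<p p<r _)   = <-trans s<p p<r
last<third (like-3241 s<q q<p p<r) = <-trans s<q (<-trans q<p p<r)

-- Avoidance for a block with letters placed around it

Inside Outside : ℕ → ℕ → ℕ → Set
Inside  e f x = e ≤ x × x < f
Outside e f x = x < e ⊎ f ≤ x

Straddles : ℕ → ℕ → ℕ → ℕ → Set
Straddles e f x y = y < e × f ≤ x

module _ {e f : ℕ} where

  -- This is applied to the first letter of a pattern, which always lies in value between two later
  -- ones.
  outside⇒¬between : ∀ {x y z} → Outside e f x → e ≤ y → z < f → y < x → x < z → ⊥
  outside⇒¬between (inj₁ x<e) e≤y _   y<x _   = <⇒≱ (<-trans y<x x<e) e≤y
  outside⇒¬between (inj₂ f≤x) _   z<f _   x<z = <⇒≱ (<-trans x<z z<f) f≤x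

  module _ {P X : List ℕ} (e≤f : e ≤ f)
           (inversions : AllPairs (λ x y → x < y ⊎ Straddles e f x y) P)
           (outside : All (Outside e f) P) (inside : All (Inside e f) X)
           (avX : Avoiding X) where

    -- An occurrence is cut by the number of its letters in P. A single one has an intermediate
    -- value, which a letter outside the interval cannot have. With more of them, an inversion in P
    -- must jump over the whole interval, against the comparisons of the pattern, except for a 2431
    -- with two letters in P, where the first letter is again intermediate.
    avoiding-straddling : Avoiding (P ++ X)
    avoiding-straddling τ bad = let us , vs , eq , σ , ρ = ⊆-++⁻ P τ in go us vs eq σ ρ bad
      where
      straddles : ∀ {x y us} → x ∷ y ∷ us ⊆ P → y < x → Straddles e f x y
      straddles σ y<x with AllPairs-resp-⊆ σ inversions
      ... | (inj₁ x<y ∷ _) ∷ _ = contradiction x<y (<-asym y<x)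
      ... | (inj₂ st  ∷ _) ∷ _ = st

      go : ∀ us vs {p q r s} → p ∷ q ∷ r ∷ s ∷ [] ≡ us ++ vs → us ⊆ P → vs ⊆ X →
           ¬ Forbidden p q r s
      go [] _ refl σ ρ bad = avX ρ bad
      go (_ ∷ []) _ refl σ ρ bad
        with out ∷ [] ← All-resp-⊆ σ outside
           | (e≤q , _) ∷ (_ , r<f) ∷ (e≤s , s<f) ∷ [] ← All-resp-⊆ ρ inside
        with bad
      ... | like-2143 q<p p<s _   = outside⇒¬between out e≤q s<f q<p p<s
      ... | like-2431 s<p p<r _   = outside⇒¬between out e≤s r<f s<p p<r
      ... | like-3241 _   q<p p<r = outside⇒¬between out e≤q r<f q<p p<r
      go (_ ∷ _ ∷ []) _ refl σ ρ bad
        with out ∷ _ ← All-resp-⊆ σ outside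
           | (_ , r<f) ∷ (e≤s , s<f) ∷ [] ← All-resp-⊆ ρ inside
        with bad
      ... | like-2143 q<p p<s _   = <⇒≱ (<-trans p<s s<f) (proj₂ (straddles σ q<p))
      ... | like-2431 s<p p<r _   = outside⇒¬between out e≤s r<f s<p p<r
      ... | like-3241 s<q q<p _   = <⇒≱ (<-trans s<q (proj₁ (straddles σ q<p))) e≤s
      go (_ ∷ _ ∷ _ ∷ []) _ refl σ ρ bad
        with (e≤s , s<f) ∷ [] ← All-resp-⊆ ρ inside
        with bad
      ... | like-2143 q<p p<s _   = <⇒≱ (<-trans p<s s<f) (proj₂ (straddles σ q<p))
      ... | like-2431 s<p p<r r<q =
        <⇒≱ (<-trans s<p (<-trans p<r (proj₁ (straddles (∷ˡ⁻ σ) r<q)))) e≤s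
      ... | like-3241 s<q q<p _   = <⇒≱ (<-trans s<q (proj₁ (straddles σ q<p))) e≤s
      -- With all four letters in P, each pattern has two inversions that cannot both jump over the
      -- interval, given `e ≤ f`.
      go (_ ∷ _ ∷ _ ∷ _ ∷ []) _ refl σ ρ bad with bad
      ... | like-2143 q<p p<s s<r = <⇒≱
        (<-trans p<s (proj₁ (straddles (∷ˡ⁻ (∷ˡ⁻ σ)) s<r)))
        (≤-trans e≤f (proj₂ (straddles σ q<p)))
      ... | like-2431 s<p p<r r<q = <⇒≱
        (<-trans p<r (proj₁ (straddles (∷ˡ⁻ σ) r<q)))
        (≤-trans e≤f (proj₂ (straddles (⊆-trans (refl ∷ skip _ (skip _ (refl ∷ []))) σ) s<p)))
      ... | like-3241 s<q q<p p<r = <⇒≱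
        (proj₁ (straddles σ q<p))
        (≤-trans e≤f (proj₂ (straddles (∷ˡ⁻ (⊆-trans (refl ∷ refl ∷ skip _ (refl ∷ [])) σ)) s<q)))

  module _ {P Y : List ℕ} (ascending : Ascending P) (outside : All (Outside e f) P)
           (above : All (e ≤_) Y)
           (inversions : AllPairs (λ x y → x < y ⊎ x < f) Y)
           (avY : Avoiding Y) where

    -- The first three letters of every pattern contain a descent, so at most two letters lie in P,
    -- and two only for 2431. The first letter then lies between a letter that is at least e and the
    -- upper end of an inversion of Y, which is below f. In the application Y is the block followed
    -- by its ascending tail.
    avoiding-ascending : Avoiding (P ++ Y)
    avoiding-ascending τ bad = let us , vs , eq , σ , ρ = ⊆-++⁻ P τ in go us vs eq σ ρ bad
      where
      below-f : ∀ {x y us} → x ∷ y ∷ us ⊆ Y → y < x → x < f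
      below-f ρ y<x with AllPairs-resp-⊆ ρ inversions
      ... | (inj₁ x<y ∷ _) ∷ _ = contradiction x<y (<-asym y<x)
      ... | (inj₂ x<f ∷ _) ∷ _ = x<f

      ¬ascending : ∀ {p q r s us} → p ∷ q ∷ r ∷ us ⊆ P → ¬ Forbidden p q r s
      ¬ascending σ bad
        with (p<q ∷ _) ∷ (q<r ∷ _) ∷ _ ← AllPairs-resp-⊆ σ ascending
        with bad
      ... | like-2143 q<p _ _ = <-asym p<q q<p
      ... | like-2431 _ _ r<q = <-asym q<r r<q
      ... | like-3241 _ q<p _ = <-asym p<q q<p

      go : ∀ us vs {p q r s} → p ∷ q ∷ r ∷ s ∷ [] ≡ us ++ vs → us ⊆ P → vs ⊆ Y →
           ¬ Forbidden p q r s
      go [] _ refl σ ρ bad = avY ρ bad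
      go (_ ∷ []) _ refl σ ρ bad
        with out ∷ [] ← All-resp-⊆ σ outside
           | e≤q ∷ e≤r ∷ e≤s ∷ [] ← All-resp-⊆ ρ above
        with bad
      ... | like-2143 q<p p<s s<r =
        outside⇒¬between out e≤q (below-f (∷ˡ⁻ ρ) s<r) q<p (<-trans p<s s<r)
      ... | like-2431 s<p p<r r<q =
        outside⇒¬between out e≤s (below-f ρ r<q) s<p (<-trans p<r r<q)
      ... | like-3241 s<q q<p p<r =
        outside⇒¬between out e≤q (below-f (∷ˡ⁻ ρ) (last<third bad)) q<p p<r
      go (_ ∷ _ ∷ []) _ refl σ ρ bad
        with out ∷ _ ← All-resp-⊆ σ outside
           | (p<q ∷ _) ∷ _ ← AllPairs-resp-⊆ σ ascending
           | e≤r ∷ e≤s ∷ [] ← All-resp-⊆ ρ above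
        with bad
      ... | like-2143 q<p _ _   = <-asym p<q q<p
      ... | like-2431 s<p p<r _ = outside⇒¬between out e≤s (below-f ρ (<-trans s<p p<r)) s<p p<r
      ... | like-3241 _ q<p _   = <-asym p<q q<p
      go (_ ∷ _ ∷ _ ∷ []) _ refl σ _ = ¬ascending σ
      go (_ ∷ _ ∷ _ ∷ _ ∷ []) _ refl σ _ = ¬ascending σ

module _ {f : ℕ} {X γ : List ℕ} (below : All (_< f) X) (above : All (f ≤_) γ)
         (ascending : Ascending γ) (avX : Avoiding X) where

  -- If the last letter of an occurrence is in γ, the third one is either in X, hence smaller, or
  -- earlier in γ, hence smaller as well; but every pattern ends in a descent.
  avoiding-++-ascending : Avoiding (X ++ γ)
  avoiding-++-ascending τ bad = let us , vs , eq , σ , ρ = ⊆-++⁻ X τ in go us vs eq σ ρ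
    where
    go : ∀ us vs → _ ≡ us ++ vs → us ⊆ X → vs ⊆ γ → ⊥
    go _ [] eq σ ρ = avX (subst (_⊆ X) (trans (sym (++-identityʳ _)) (sym eq)) σ) bad
    go (_ ∷ _ ∷ _ ∷ []) (_ ∷ []) refl σ ρ
      with _ ∷ _ ∷ r<f ∷ [] ← All-resp-⊆ σ below
         | f≤s ∷ [] ← All-resp-⊆ ρ above
      = <⇒≱ (<-trans (last<third bad) r<f) f≤s
    go [] (_ ∷ _ ∷ _ ∷ _ ∷ []) refl σ ρ
      with _ ∷ _ ∷ (r<s ∷ []) ∷ _ ← AllPairs-resp-⊆ ρ ascending = <-asym r<s (last<third bad)
    go (_ ∷ []) (_ ∷ _ ∷ _ ∷ []) refl σ ρ
      with _ ∷ (r<s ∷ []) ∷ _ ← AllPairs-resp-⊆ ρ ascending = <-asym r<s (last<third bad)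
    go (_ ∷ _ ∷ []) (_ ∷ _ ∷ []) refl σ ρ
      with (r<s ∷ []) ∷ _ ← AllPairs-resp-⊆ ρ ascending = <-asym r<s (last<third bad)
    go (_ ∷ _ ∷ _ ∷ _ ∷ []) (_ ∷ _) ()
    go (_ ∷ _ ∷ _ ∷ _ ∷ _ ∷ _) (_ ∷ _) ()

-- Intervals of values

range : ℕ → ℕ → List ℕ
range = iterate suc

range-++ : ∀ c m n → range c (m + n) ≡ range c m ++ range (c + m) n
range-++ c zero    n = cong (λ d → range d n) (sym (+-identityʳ c))
range-++ c (suc m) n = cong (c ∷_) (trans (range-++ (suc c) m n)
  (cong (λ d → range (suc c) m ++ range d n) (sym (+-suc c m))))

range-∷ʳ : ∀ c n → range c (suc n) ≡ range c n ∷ʳ (c + n)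
range-∷ʳ c n = trans (cong (range c) (+-comm 1 n)) (range-++ c n 1)

range-inside : ∀ c n → All (Inside c (c + n)) (range c n)
range-inside c zero    = []
range-inside c (suc n) = (≤-refl , m<m+n c z<s) ∷
  All.map (λ (l , u) → <⇒≤ l , ≤-trans u (≤-reflexive (sym (+-suc c n)))) (range-inside (suc c) n)

range-ascending : ∀ c n → Ascending (range c n)
range-ascending c zero    = []
range-ascending c (suc n) = All.map proj₁ (range-inside (suc c) n) ∷ range-ascending (suc c) n

↭range⇒inside : ∀ {c n π} → π ↭ range c n → All (Inside c (c + n)) π
↭range⇒inside {c} {n} p = All-resp-↭ (↭-sym p) (range-inside c n)

insert-max : ∀ {c n} α {β} → α ++ β ↭ range c n → α ++ (c + n) ∷ β ↭ range c (suc n)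
insert-max {c} {n} α {β} p = begin
  α ++ (c + n) ∷ β       ↭⟨ shift (c + n) α β ⟩
  (c + n) ∷ (α ++ β)     ↭⟨ prep (c + n) p ⟩
  (c + n) ∷ range c n    ↭⟨ ∷↭∷ʳ (c + n) (range c n) ⟩
  range c n ∷ʳ (c + n)   ≡⟨ range-∷ʳ c n ⟨
  range c (suc n)        ∎
  where open PermutationReasoning

delete-max : ∀ {c n} α {β} → α ++ (c + n) ∷ β ↭ range c (suc n) → α ++ β ↭ range c n
delete-max {c} {n} α {β} p = drop-∷ (begin
  (c + n) ∷ (α ++ β)     ↭⟨ shift (c + n) α β ⟨
  α ++ (c + n) ∷ β       ↭⟨ p ⟩
  range c (suc n)        ≡⟨ range-∷ʳ c n ⟩
  range c n ∷ʳ (c + n)   ↭⟨ ∷↭∷ʳ (c + n) (range c n) ⟨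
  (c + n) ∷ range c n    ∎)
  where open PermutationReasoning

-- Allowing any interval c, …, c + n − 1 of values, a block of a permutation is
-- again an object of this kind, without standardisation.
Avoider : ℕ → ℕ → List ℕ → Set
Avoider c n π = π ↭ range c n × Avoiding π

-- Bit strings describing the letters outside the block

Bits : Set
Bits = List Bool

zeros ones : Bits → ℕ
zeros []          = 0
zeros (false ∷ w) = suc (zeros w)
zeros (true  ∷ w) = zeros w
ones []          = 0
ones (false ∷ w) = ones w
ones (true  ∷ w) = suc (ones w)

zeros+ones : ∀ w → zeros w + ones w ≡ length w
zeros+ones []          = refl
zeros+ones (false ∷ w) = cong suc (zeros+ones w)
zeros+ones (true  ∷ w) = trans (+-suc (zeros w) (ones w)) (cong suc (zeros+ones w))

-- A bit says whether the letter at its position is low (false) or high (true).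
shuffle : Bits → ℕ → ℕ → List ℕ
shuffle []          l h = []
shuffle (false ∷ w) l h = l ∷ shuffle w (suc l) h
shuffle (true  ∷ w) l h = h ∷ shuffle w l (suc h)

shuffle-↭ : ∀ w l h → shuffle w l h ↭ range l (zeros w) ++ range h (ones w)
shuffle-↭ []          l h = ↭-refl
shuffle-↭ (false ∷ w) l h = prep l (shuffle-↭ w (suc l) h)
shuffle-↭ (true  ∷ w) l h =
  ↭-trans (prep h (shuffle-↭ w l (suc h))) (↭-sym (shift h (range l (zeros w)) _))

shuffle-bounds : ∀ w l h →
  All (λ x → Inside l (l + zeros w) x ⊎ Inside h (h + ones w) x) (shuffle w l h)
shuffle-bounds w l h = All-resp-↭ (↭-sym (shuffle-↭ w l h))
  (All.++⁺ (All.map inj₁ (range-inside l (zeros w))) (All.map inj₂ (range-inside h (ones w))))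

-- Both runs increase, so an inversion can only be a high letter before a low one; the low run stays
-- below e and the high run starts at f or later.
shuffle-straddles : ∀ w l h {e f} → l + zeros w ≤ e → e ≤ f → f ≤ h →
  AllPairs (λ x y → x < y ⊎ Straddles e f x y) (shuffle w l h)
shuffle-straddles []          l h _ _ _ = []
shuffle-straddles (false ∷ w) l h {e} l≤ e≤f f≤h =
  All.map [ (λ (l<x , _) → inj₁ l<x)
          , (λ (h≤x , _) → inj₁ (<-≤-trans (m+n≤o⇒m≤o (suc l) l+w<e)
                                          (≤-trans e≤f (≤-trans f≤h h≤x)))) ]
    (shuffle-bounds w (suc l) h)
  ∷ shuffle-straddles w (suc l) h l+w<e e≤f f≤h
  where
  l+w<e : suc l + zeros w ≤ e
  l+w<e = subst (_≤ e) (+-suc l (zeros w)) l≤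
shuffle-straddles (true ∷ w) l h l≤ e≤f f≤h =
  All.map [ (λ (_ , x<) → inj₂ (<-≤-trans x< l≤ , f≤h)) , (λ (h<x , _) → inj₁ h<x) ]
    (shuffle-bounds w l (suc h))
  ∷ shuffle-straddles w l (suc h) l≤ e≤f (m≤n⇒m≤1+n f≤h)

-- Here a bit says on which side of the maximum the value at its index stands.
lefts rights : Bits → ℕ → List ℕ
lefts []          b = []
lefts (false ∷ w) b = lefts w (suc b)
lefts (true  ∷ w) b = b ∷ lefts w (suc b)
rights []          b = []
rights (false ∷ w) b = b ∷ rights w (suc b)
rights (true  ∷ w) b = rights w (suc b)

lefts-rights-↭ : ∀ w b → lefts w b ++ rights w b ↭ range b (length w)
lefts-rights-↭ []          b = ↭-refl
lefts-rights-↭ (false ∷ w) b =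
  ↭-trans (shift b (lefts w (suc b)) _) (prep b (lefts-rights-↭ w (suc b)))
lefts-rights-↭ (true  ∷ w) b = prep b (lefts-rights-↭ w (suc b))

lefts-inside : ∀ w b → All (Inside b (b + length w)) (lefts w b)
lefts-inside w b = All.++⁻ˡ (lefts w b) (↭range⇒inside (lefts-rights-↭ w b))

rights-inside : ∀ w b → All (Inside b (b + length w)) (rights w b)
rights-inside w b = All.++⁻ʳ (lefts w b) (↭range⇒inside (lefts-rights-↭ w b))

lefts-ascending : ∀ w b → Ascending (lefts w b)
lefts-ascending []          b = []
lefts-ascending (false ∷ w) b = lefts-ascending w (suc b)
lefts-ascending (true  ∷ w) b =
  All.map proj₁ (lefts-inside w (suc b)) ∷ lefts-ascending w (suc b)

rights-ascending : ∀ w b → Ascending (rights w b)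
rights-ascending []          b = []
rights-ascending (false ∷ w) b =
  All.map proj₁ (rights-inside w (suc b)) ∷ rights-ascending w (suc b)
rights-ascending (true  ∷ w) b = rights-ascending w (suc b)

-- The leading false bits stand for the letters below the block X, the first true
-- bit for the least letter above it, which always stands before the maximum; the
-- remaining bits are read as in lefts and rights.
start : Bits → ℕ → ℕ
start []          c = c
start (false ∷ w) c = start w (suc c)
start (true  ∷ w) c = c

≤start : ∀ w c → c ≤ start w c
≤start []          c = ≤-refl
≤start (false ∷ w) c = <⇒≤ (≤start w (suc c))
≤start (true  ∷ w) c = ≤-refl

before after : Bits → ℕ → ℕ → List ℕ
before []          c m = []
before (false ∷ w) c m = c ∷ before w (suc c) m
before (true  ∷ w) c m = (c + m) ∷ lefts w (suc (c + m))
after []          c m = []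
after (false ∷ w) c m = after w (suc c) m
after (true  ∷ w) c m = rights w (suc (c + m))

before-after-↭ : ∀ w c {m X} → X ↭ range (start w c) m →
  before w c m ++ (X ++ after w c m) ↭ range c (length w + m)
before-after-↭ []          c {X = X} p = ↭-trans (↭-reflexive (++-identityʳ X)) p
before-after-↭ (false ∷ w) c p = prep c (before-after-↭ w (suc c) p)
before-after-↭ (true  ∷ w) c {m} {X} p = begin
  (b ∷ L) ++ (X ++ R)                      ↭⟨ shifts (b ∷ L) X ⟩
  X ++ (b ∷ L ++ R)                        ↭⟨ ++⁺ p (prep b (lefts-rights-↭ w (suc b))) ⟩
  range c m ++ range (c + m) (suc (length w)) ≡⟨ range-++ c m (suc (length w)) ⟨
  range c (m + suc (length w))             ≡⟨ cong (range c) (+-comm m (suc (length w))) ⟩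
  range c (suc (length w) + m)             ∎
  where
  open PermutationReasoning
  b = c + m
  L = lefts w (suc b)
  R = rights w (suc b)

before-inside : ∀ w c m → All (Inside c (c + (length w + m))) (before w c m)
-- `before` depends on the block only through its length, so the sorted interval can serve as the
-- block.
before-inside w c m = All.++⁻ˡ (before w c m) (↭range⇒inside (before-after-↭ w c ↭-refl))

before-ascending : ∀ w c m → Ascending (before w c m)
before-ascending []          c m = []
before-ascending (false ∷ w) c m =
  All.map proj₁ (before-inside w (suc c) m) ∷ before-ascending w (suc c) m
before-ascending (true  ∷ w) c m =
  All.map proj₁ (lefts-inside w (suc (c + m))) ∷ lefts-ascending w (suc (c + m))

before-outside : ∀ w c m → All (Outside (start w c) (start w c + m)) (before w c m)
before-outside []          c m = []
before-outside (false ∷ w) c m = inj₁ (≤start w (suc c)) ∷ before-outside w (suc c) m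
before-outside (true  ∷ w) c m =
  inj₂ ≤-refl ∷ All.map (λ (b<x , _) → inj₂ (<⇒≤ b<x)) (lefts-inside w (suc (c + m)))

after-above : ∀ w c m → All (start w c + m ≤_) (after w c m)
after-above []          c m = []
after-above (false ∷ w) c m = after-above w (suc c) m
after-above (true  ∷ w) c m = All.map (λ (b<x , _) → <⇒≤ b<x) (rights-inside w (suc (c + m)))

after-ascending : ∀ w c m → Ascending (after w c m)
after-ascending []          c m = []
after-ascending (false ∷ w) c m = after-ascending w (suc c) m
after-ascending (true  ∷ w) c m = rights-ascending w (suc (c + m))

-- The constructions from codes, and their avoidance

Code : Set
Code = Bits × List ℕ

-- The two kinds of codes differ only in `start`, the least value of the block. Nonemptiness
-- separates them from the case of a final maximum and lets the code be read off the word.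
Valid : (Bits → ℕ) → ℕ → Code → Set
Valid start n (w , X) = length w + length X ≡ n × 0 < length X × Avoider (start w) (length X) X

ValidShuffled ValidLayered : ℕ → ℕ → Code → Set
ValidShuffled c = Valid (λ w → c + zeros w)
ValidLayered  c = Valid (λ w → start w c)

shuffled : ℕ → ℕ → Code → List ℕ
shuffled c D (w , X) = shuffle w c (c + zeros w + length X) ++ D ∷ X

layered : ℕ → ℕ → Code → List ℕ
layered c D (w , X) = before w c (length X) ++ D ∷ (X ++ after w c (length X))

-- The maximum on its own is an ascending tail above everything else.
∷ʳ-avoider : ∀ {c n α} → Avoider c n α → Avoider c (suc n) (α ∷ʳ (c + n))
∷ʳ-avoider {c} {n} {α} (p , av) =
  insert-max α (↭-trans (↭-reflexive (++-identityʳ α)) p) ,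
  avoiding-++-ascending (All.map proj₂ (↭range⇒inside p)) (≤-refl ∷ []) ([] ∷ []) av

private
  -- For the avoidance lemmas D counts as the last letter of the prefix, where it is the upper end
  -- of no inversion and lies above the block; it then needs no cases of its own.
  ∷ʳ-++ : ∀ (α : List ℕ) {D β} → Avoiding ((α ∷ʳ D) ++ β) → Avoiding (α ++ D ∷ β)
  ∷ʳ-++ α = subst Avoiding (++-assoc α _ _)

shuffled-avoider : ∀ {c n} code → ValidShuffled c n code →
                   Avoider c (suc n) (shuffled c (c + n) code)
shuffled-avoider {c} (w , X) (refl , _ , p , av) =
  insert-max P perm , ∷ʳ-++ P (avoiding-straddling e≤f
    (AllPairs.++⁺ (shuffle-straddles w c f ≤-refl e≤f ≤-refl) ([] ∷ [])
                  (All.map (λ x<D → inj₁ x<D ∷ []) P<D))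
    (All.++⁺ (All.map [ (λ (_ , x<e) → inj₁ x<e) , (λ (f≤x , _) → inj₂ f≤x) ]
                      (shuffle-bounds w c f))
             (inj₂ f≤D ∷ []))
    (↭range⇒inside p) av)
  where
  m e f D : ℕ
  m = length X
  e = c + zeros w
  f = e + m
  D = c + (length w + m)
  P = shuffle w c f
  e≤f : e ≤ f
  e≤f = m≤m+n e m
  f≤D : f ≤ D
  f≤D = ≤-trans (≤-reflexive (+-assoc c (zeros w) m))
    (+-monoʳ-≤ c (+-monoˡ-≤ m (≤-trans (m≤m+n (zeros w) (ones w)) (≤-reflexive (zeros+ones w)))))
  perm : P ++ X ↭ range c (length w + m)
  perm = begin
    P ++ X                             ↭⟨ ++⁺ (shuffle-↭ w c f) p ⟩
    (L ++ range f (ones w)) ++ range e m ≡⟨ ++-assoc L _ _ ⟩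
    L ++ (range f (ones w) ++ range e m) ↭⟨ ++⁺ˡ L (++-comm (range f (ones w)) _) ⟩
    L ++ (range e m ++ range f (ones w)) ≡⟨ cong (L ++_) (range-++ e m (ones w)) ⟨
    L ++ range e (m + ones w)            ≡⟨ range-++ c (zeros w) (m + ones w) ⟨
    range c (zeros w + (m + ones w))     ≡⟨ cong (range c) (rearrange (zeros w) m (ones w)) ⟩
    range c (zeros w + ones w + m)       ≡⟨ cong (λ k → range c (k + m)) (zeros+ones w) ⟩
    range c (length w + m)               ∎
    where
    open PermutationReasoning
    L = range c (zeros w)
    rearrange : ∀ a b c → a + (b + c) ≡ a + c + b
    rearrange = solve-∀
  P<D : All (_< D) P
  P<D = All.map proj₂ (All.++⁻ˡ P (↭range⇒inside perm))

layered-avoider : ∀ {c n} code → ValidLayered c n code →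
                  Avoider c (suc n) (layered c (c + n) code)
layered-avoider {c} (w , X) (refl , _ , p , av) =
  insert-max P perm , ∷ʳ-++ P (avoiding-ascending
    (AllPairs.++⁺ (before-ascending w c m) ([] ∷ [])
                  (All.map (λ (_ , x<D) → x<D ∷ []) (before-inside w c m)))
    (All.++⁺ (before-outside w c m) (inj₂ f≤D ∷ []))
    (All.++⁺ (All.map proj₁ X-inside) (All.map (≤-trans e≤f) (after-above w c m)))
    -- A pair of letters after D either starts in X, hence below f, or lies in the ascending tail.
    (AllPairs.++⁺ (AllPairs-tabulate λ τ → inj₂ (proj₂ (All.lookup X-inside (to∈ τ))))
                  (AllPairs.map inj₁ (after-ascending w c m))
                  (All.map (λ (_ , x<f) → All.tabulate λ _ → inj₂ x<f) X-inside))
    (avoiding-++-ascending (All.map proj₂ X-inside) (after-above w c m) (after-ascending w c m) av))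
  where
  m e f D : ℕ
  m = length X
  e = start w c
  f = e + m
  D = c + (length w + m)
  P = before w c m
  X-inside = ↭range⇒inside p
  e≤f : e ≤ f
  e≤f = m≤m+n e m
  start≤ : ∀ w c → start w c ≤ c + length w
  start≤ []          c = m≤m+n c 0
  start≤ (false ∷ w) c = ≤-trans (start≤ w (suc c)) (≤-reflexive (sym (+-suc c (length w))))
  start≤ (true  ∷ w) c = m≤m+n c _
  f≤D : f ≤ D
  f≤D = ≤-trans (+-monoˡ-≤ m (start≤ w c)) (≤-reflexive (+-assoc c (length w) m))
  perm : P ++ (X ++ after w c m) ↭ range c (length w + m)
  perm = before-after-↭ w c p

-- Reading the code off an avoider

↭range⇒unique : ∀ {c n π} → π ↭ range c n → Unique π
↭range⇒unique {c} {n} p =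
  Permutation.Unique-resp-↭ (setoid ℕ) (↭⇒↭ₛ (↭-sym p)) (AllPairs.map <⇒≢ (range-ascending c n))

↭range⇒length : ∀ {c n π} → π ↭ range c n → length π ≡ n
↭range⇒length {c} {n} p = trans (↭-length p) (length-iterate suc c n)

min∈ : ∀ {c n π} → π ↭ range c (suc n) → c ∈ π
min∈ p = ∈-resp-↭ (↭-sym p) (here refl)

min≤ : ∀ {c n π x} → π ↭ range c n → x ∈ π → c ≤ x
min≤ p x∈ = proj₁ (All.lookup (↭range⇒inside p) x∈)

ascending-head : ∀ {b xs} → Ascending xs → All (b ≤_) xs → b ∈ xs → ∃[ ys ] xs ≡ b ∷ ys
ascending-head (_ ∷ _)    _         (here refl) = _ , refl
ascending-head (x<xs ∷ _) (b≤x ∷ _) (there b∈) = contradiction (All.lookup x<xs b∈) (≤⇒≯ b≤x)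

ascending-↭range⇒≡ : ∀ {c} n {xs} → Ascending xs → xs ↭ range c n → xs ≡ range c n
ascending-↭range⇒≡ zero    asc p = ↭-empty-inv p
ascending-↭range⇒≡ (suc n) asc p
  with ys , refl ← ascending-head asc (All.map proj₁ (↭range⇒inside p)) (min∈ p)
  = cong (_ ∷_) (ascending-↭range⇒≡ n (AllPairs.tail asc) (drop-∷ p))

-- As long as xs is nonempty, the least value must be in xs, and it is removed there. In this way
-- comparisons alone yield blocks of consecutive values.
range-split : ∀ {c} n {xs ys} → (∀ {x y} → x ∈ xs → y ∈ ys → x < y) → xs ++ ys ↭ range c n →
  xs ↭ range c (length xs) × ys ↭ range (c + length xs) (length ys)
range-split {c} n {[]} {ys} _ p =
  ↭-refl , subst₂ (λ d k → ys ↭ range d k) (sym (+-identityʳ c)) (sym (↭range⇒length p)) p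
range-split zero {_ ∷ _} _ p = contradiction p ¬x∷xs↭[]
range-split {c} (suc n) {xs@(_ ∷ _)} {ys} below p with ∈-++⁻ xs (min∈ p)
... | inj₂ c∈ys = contradiction (below (here refl) c∈ys) (≤⇒≯ (min≤ p (here refl)))
... | inj₁ c∈xs with xs₁ , xs₂ , eq ← ∈-∃++ c∈xs =
  subst (λ k → xs ↭ range c k) (sym len) (↭-trans xs↭ (prep c (proj₁ rec))) ,
  subst (λ d → ys ↭ range d (length ys)) (trans (sym (+-suc c _)) (cong (c +_) (sym len)))
    (proj₂ rec)
  where
  xs↭ : xs ↭ c ∷ xs₁ ++ xs₂
  xs↭ = ↭-trans (↭-reflexive eq) (shift c xs₁ xs₂)
  len : length xs ≡ suc (length (xs₁ ++ xs₂))
  len = ↭-length xs↭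
  rec = range-split n {xs₁ ++ xs₂} {ys}
    (λ x∈ → below (∈-resp-↭ (↭-sym xs↭) (there x∈)))
    (drop-∷ (↭-trans (++⁺ʳ ys (↭-sym xs↭)) p))

-- The least value heads one of the two ascending lists, and the bit records which.
lefts-rights-complete : ∀ {b} r {xs ys} → Ascending xs → Ascending ys → xs ++ ys ↭ range b r →
  ∃[ w ] length w ≡ r × xs ≡ lefts w b × ys ≡ rights w b
lefts-rights-complete zero {xs} {ys} _ _ p =
  [] , refl , ++-conicalˡ xs ys (↭-empty-inv p) , ++-conicalʳ xs ys (↭-empty-inv p)
lefts-rights-complete {b} (suc r) {xs} {ys} ascx ascy p
  with above ← All.map proj₁ (↭range⇒inside p)
  with ∈-++⁻ xs (min∈ p)
... | inj₁ b∈ with xs′ , refl ← ascending-head ascx (All.++⁻ˡ xs above) b∈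
  with w , len , eqx , eqy ← lefts-rights-complete r (AllPairs.tail ascx) ascy (drop-∷ p)
  = true ∷ w , cong suc len , cong (b ∷_) eqx , eqy
... | inj₂ b∈ with ys′ , refl ← ascending-head ascy (All.++⁻ʳ xs above) b∈
  with w , len , eqx , eqy ← lefts-rights-complete r ascx (AllPairs.tail ascy)
         (drop-∷ (↭-trans (↭-sym (shift b xs ys′)) p))
  = false ∷ w , cong suc len , eqx , cong (b ∷_) eqy

module _ {A : Set} {P : A → Set} (P? : Decidable P) where

  filter-++-filter : ∀ {xs} → AllPairs (λ x y → P x ⊎ ¬ P y) xs →
                     xs ≡ filter P? xs ++ filter (∁? P?) xs
  filter-++-filter [] = refl
  filter-++-filter {x ∷ xs} (px ∷ ps) with P? x
  ... | yes _  = cong (x ∷_) (filter-++-filter ps)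
  ... | no ¬Px = subst (λ zs → x ∷ xs ≡ zs ++ x ∷ filter (∁? P?) xs)
    (sym (filter-none P? none))
    (cong (x ∷_) (trans (filter-++-filter ps) (cong (_++ filter (∁? P?) xs) (filter-none P? none))))
    where
    none = All.map [ (λ Px → contradiction Px ¬Px) , (λ ¬Py → ¬Py) ] px

  filter-↭-filter : ∀ xs → xs ↭ filter P? xs ++ filter (∁? P?) xs
  filter-↭-filter []       = ↭-refl
  filter-↭-filter (x ∷ xs) with P? x
  ... | yes _ = prep x (filter-↭-filter xs)
  ... | no  _ = ↭-trans (prep x (filter-↭-filter xs)) (↭-sym (shift x (filter P? xs) _))

unique∧¬descent⇒ascending : ∀ {xs} → Unique xs → (∀ {x y} → x ∷ y ∷ [] ⊆ xs → ¬ y < x) →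
                            Ascending xs
unique∧¬descent⇒ascending uniq ¬descent =
  AllPairs-tabulate λ τ → ≤∧≢⇒< (≮⇒≥ (¬descent τ)) (AllPairs-lookup uniq τ)

unique-cross : ∀ {A : Set} {xs ys : List A} {x y} → Unique (xs ++ ys) → x ∈ xs → y ∈ ys → x ≢ y
unique-cross uniq x∈ y∈ = AllPairs-lookup uniq (Sub.++⁺ (from∈ x∈) (from∈ y∈))

-- Leading letters of α equal to the current least value are peeled off: they lie below the block.
-- At the first letter a exceeding that value, the block is the part of β below a; it contains the
-- least value, and a is the least letter above it. If α runs out, all of β is the block.
layered-complete : ∀ α {c n D β} → Ascending α → α ++ β ↭ range c n → 0 < length β →
  c + n ≤ D → Avoiding (α ++ D ∷ β) →
  ∃₂ λ w X → ValidLayered c n (w , X) ×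
    α ≡ before w c (length X) × β ≡ X ++ after w c (length X)
layered-complete [] {β = β} _ p 0<β _ av =
  [] , β , (↭range⇒length p , 0<β ,
            subst (λ k → β ↭ range _ k) (sym (↭range⇒length p)) p , avoiding-⊆ (skip _ ⊆-refl) av) ,
  refl , sym (++-identityʳ β)
layered-complete (_ ∷ _) {n = zero} _ p = contradiction p ¬x∷xs↭[]
layered-complete (a ∷ α) {c} {suc n} {D} {β} (a<α ∷ asc) p 0<β c+n≤D av with a ≟ c
... | yes refl
  with w , X , (len , valid) , eqα , eqβ ←
    layered-complete α asc (drop-∷ p) 0<β (≤-trans (≤-reflexive (sym (+-suc c n))) c+n≤D)
      (avoiding-⊆ (skip a ⊆-refl) av)
  = false ∷ w , X , (cong suc len , valid) , cong (a ∷_) eqα , eqβ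
... | no a≢c =
  let w , len , eqα , eqγ = lefts-rights-complete _ asc γ-ascending tail↭ in
  true ∷ w , X ,
    (trans (cong (λ k → suc k + length X) len) total , ∈-length c∈X , X↭ ,
      avoiding-⊆ (skip a (⊆-trans (skip D (filter-⊆ (_<? a) β)) (Sub.++⁺ˡ α ⊆-refl))) av) ,
    cong₂ _∷_ a≡b (trans eqα (cong (λ b → lefts w (suc b)) a≡b)) ,
    trans β≡ (cong (X ++_) (trans eqγ (cong (λ b → rights w (suc b)) a≡b)))
  where
  X γ : List ℕ
  X = filter (_<? a) β
  γ = filter (∁? (_<? a)) β

  c<a : c < a
  c<a = ≤∧≢⇒< (min≤ p (here refl)) (λ c≡a → a≢c (sym c≡a))

  unique : Unique (a ∷ α ++ β)
  unique = ↭range⇒unique p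

  c∈β : c ∈ β
  c∈β with ∈-++⁻ (a ∷ α) (min∈ p)
  ... | inj₁ (here refl) = contradiction refl a≢c
  ... | inj₁ (there c∈α) = contradiction (All.lookup a<α c∈α) (<-asym c<a)
  ... | inj₂ c∈          = c∈

  c∈X : c ∈ X
  c∈X = ∈-filter⁺ (_<? a) c∈β c<a

  <D : ∀ {b} → b ∈ β → b < D
  <D b∈ = <-≤-trans (proj₂ (All.lookup (↭range⇒inside p) (∈-++⁺ʳ (a ∷ α) b∈))) c+n≤D

  -- Were some y above a to precede some z below a in β, the letters a, D, y, z would form 2431.
  β≡ : β ≡ X ++ γ
  β≡ = filter-++-filter (_<? a) (AllPairs-tabulate small-first)
    where
    small-first : ∀ {y z} → y ∷ z ∷ [] ⊆ β → y < a ⊎ ¬ z < a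
    small-first {y} {z} τ with <-cmp y a
    ... | tri< y<a _ _  = inj₁ y<a
    ... | tri≈ _ refl _ = contradiction refl
      (unique-cross {xs = a ∷ α} unique (here refl) (to∈ τ))
    ... | tri> _ _ a<y  = inj₂ λ z<a →
      av (refl ∷ Sub.++⁺ (minimum α) (refl ∷ τ)) (like-2431 z<a a<y (<D (to∈ τ)))

  -- The least value c is in X, so it precedes γ, and a descent r, s of γ would complete a, c to
  -- 2143.
  γ-ascending : Ascending γ
  γ-ascending = unique∧¬descent⇒ascending
    (AllPairs-resp-⊆ (Sub.++⁺ˡ (a ∷ α) (filter-⊆ (∁? (_<? a)) β)) unique) ¬descent
    where
    ¬descent : ∀ {r s} → r ∷ s ∷ [] ⊆ γ → ¬ s < r
    ¬descent {r} {s} τ s<r =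
      av (refl ∷ Sub.++⁺ (minimum α) (skip D
           (subst (c ∷ r ∷ s ∷ [] ⊆_) (sym β≡) (Sub.++⁺ (from∈ c∈X) τ))))
         (like-2143 c<a (≤∧≢⇒< (≮⇒≥ (proj₂ s∈)) a≢s) s<r)
      where
      s∈ : s ∈ β × ¬ s < a
      s∈ = ∈-filter⁻ (∁? (_<? a)) {xs = β} (to∈ (∷ˡ⁻ τ))
      a≢s : a ≢ s
      a≢s = unique-cross {xs = a ∷ α} unique (here refl) (proj₁ s∈)

  α∪γ : List ℕ
  α∪γ = a ∷ (α ++ γ)

  a≤ : All (a ≤_) α∪γ
  a≤ = ≤-refl ∷ All.++⁺ (All.map <⇒≤ a<α)
    (All.tabulate λ s∈ → ≮⇒≥ (proj₂ (∈-filter⁻ (∁? (_<? a)) {xs = β} s∈)))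

  regroup : X ++ α∪γ ↭ range c (suc n)
  regroup = ↭-trans (↭-sym (shifts (a ∷ α) X))
    (subst (λ zs → (a ∷ α) ++ zs ↭ range c (suc n)) β≡ p)

  parts = range-split (suc n) {X} {α∪γ}
    (λ x∈ y∈ → <-≤-trans (proj₂ (∈-filter⁻ (_<? a) {xs = β} x∈)) (All.lookup a≤ y∈)) regroup
  X↭ = proj₁ parts

  a≡b : a ≡ c + length X
  a≡b = ≤-antisym (All.lookup a≤ (min∈ (proj₂ parts))) (min≤ (proj₂ parts) (here refl))

  tail↭ : α ++ γ ↭ range (suc a) (length (α ++ γ))
  tail↭ = drop-∷ (subst (λ d → α∪γ ↭ range d (length α∪γ)) (sym a≡b) (proj₂ parts))

  total : suc (length (α ++ γ)) + length X ≡ suc n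
  total = trans (+-comm _ (length X)) (trans (sym (length-++ X)) (↭range⇒length regroup))

module _ {A : Set} {R : A → A → Set} (R? : Binary.Decidable R) where

  ¬AllPairs⇒pair : ∀ {xs} → ¬ AllPairs R xs → ∃₂ λ x y → x ∷ y ∷ [] ⊆ xs × ¬ R x y
  ¬AllPairs⇒pair {[]}     ¬ps = contradiction [] ¬ps
  ¬AllPairs⇒pair {x ∷ xs} ¬ps with All.all? (R? x) xs
  ... | yes px = let y , z , τ , ¬r = ¬AllPairs⇒pair (λ ps → ¬ps (px ∷ ps)) in y , z , skip x τ , ¬r
  ... | no ¬px = let y , y∈ , ¬r = find (All.¬All⇒Any¬ (R? x) xs ¬px) in
    x , y , refl ∷ from∈ y∈ , ¬r

-- Every position is left of v or right of u, so any letter can be compared with one end of a fixed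
-- descent.
⊆-pair : ∀ {A : Set} {u v x : A} {xs} → u ∷ v ∷ [] ⊆ xs → x ∈ xs → x ∷ v ∷ [] ⊆ xs ⊎ u ∷ x ∷ [] ⊆ xs
⊆-pair (skip _ τ) (here refl) = inj₁ (refl ∷ ∷ˡ⁻ τ)
⊆-pair (skip _ τ) (there x∈)  = [ (λ σ → inj₁ (skip _ σ)) , (λ σ → inj₂ (skip _ σ)) ] (⊆-pair τ x∈)
⊆-pair (refl ∷ τ) (here refl) = inj₁ (refl ∷ τ)
⊆-pair (refl ∷ τ) (there x∈)  = inj₂ (refl ∷ from∈ x∈)

-- Some true bit precedes a false one; this is exactly when the shuffle has a descent, provided the
-- high run starts above the low one.
Unsorted : Bits → Set
Unsorted []          = ⊥
Unsorted (false ∷ w) = Unsorted w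
Unsorted (true  ∷ w) = false ∈ w

unsorted? : Decidable Unsorted
unsorted? []          = no λ ()
unsorted? (false ∷ w) = unsorted? w
unsorted? (true  ∷ w) = false ∈? w

zeros≡0 : ∀ w → ¬ false ∈ w → zeros w ≡ 0
zeros≡0 []          _ = refl
zeros≡0 (false ∷ w) ∉ = contradiction (here refl) ∉
zeros≡0 (true  ∷ w) ∉ = zeros≡0 w (λ ∈w → ∉ (there ∈w))

¬unsorted⇒ascending : ∀ w {l h} → ¬ Unsorted w → l + zeros w ≤ h → Ascending (shuffle w l h)
¬unsorted⇒ascending []          _ _ = []
¬unsorted⇒ascending (false ∷ w) {l} {h} ¬uns l≤ =
  All.map [ proj₁ , (λ (h≤x , _) → <-≤-trans (m+n≤o⇒m≤o (suc l) l<) h≤x) ]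
    (shuffle-bounds w (suc l) h)
  ∷ ¬unsorted⇒ascending w ¬uns l<
  where
  l< : suc l + zeros w ≤ h
  l< = ≤-trans (≤-reflexive (sym (+-suc l (zeros w)))) l≤
¬unsorted⇒ascending (true ∷ w) {l} {h} ∉w l≤ =
  All.map [ (λ (l≤x , x<) → contradiction x< (≤⇒≯ (≤-trans (≤-reflexive l+0) l≤x))) , proj₁ ]
    (shuffle-bounds w l (suc h))
  ∷ ¬unsorted⇒ascending w (λ uns → ∉w (false∈ w uns)) (≤-trans l≤ (n≤1+n h))
  where
  l+0 : l + zeros w ≡ l
  l+0 = trans (cong (l +_) (zeros≡0 w ∉w)) (+-identityʳ l)
  false∈ : ∀ w → Unsorted w → false ∈ w
  false∈ (false ∷ w) _  = here refl
  false∈ (true  ∷ w) ∈w = there ∈w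

length-shuffle : ∀ w l h → length (shuffle w l h) ≡ length w
length-shuffle []          l h = refl
length-shuffle (false ∷ w) l h = cong suc (length-shuffle w (suc l) h)
length-shuffle (true  ∷ w) l h = cong suc (length-shuffle w l (suc h))

module _ {P : ℕ → Set} (P? : Decidable P) where

  shuffle-complete : ∀ xs {l h} j k → filter P? xs ≡ range l j → filter (∁? P?) xs ≡ range h k →
    ∃[ w ] zeros w ≡ j × xs ≡ shuffle w l h
  shuffle-complete []       zero    _ _   _   = [] , refl , refl
  shuffle-complete (x ∷ xs) j       k eqj eqk with P? x
  shuffle-complete (x ∷ xs) (suc j) k eqj eqk | yes _
    with refl , eqj′ ← ∷-injective eqj
    with w , z , eq ← shuffle-complete xs j k eqj′ eqk
    = false ∷ w , cong suc z , cong (x ∷_) eq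
  shuffle-complete (x ∷ xs) j (suc k) eqj eqk | no _
    with refl , eqk′ ← ∷-injective eqk
    with w , z , eq ← shuffle-complete xs j k eqj eqk′
    = true ∷ w , z , cong (x ∷_) eq

-- The first letter y of β serves as pivot and splits α into A below and H above. Every inversion of
-- α has all of β between its ends, so neither A nor H contains one, and in value A, β, H are
-- stacked in this order.
shuffled-complete : ∀ α {c n y β} (let D = c + n) →
  ¬ Ascending α → α ++ y ∷ β ↭ range c n → Avoiding (α ++ D ∷ y ∷ β) →
  ∃[ w ] Unsorted w × ValidShuffled c n (w , y ∷ β) ×
    α ≡ shuffle w c (c + zeros w + length (y ∷ β))
shuffled-complete α {c} {n} {y} {β′} ¬asc p av =
  let w , z , eq = shuffle-complete (_<? y) α (length A) (length H)
        (ascending-↭range⇒≡ _ A-ascending A↭)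
        (ascending-↭range⇒≡ _ H-ascending H↭)
      h≡ = cong (λ k → c + k + length β) z
      α≡ = trans eq (cong (shuffle w c) (sym h≡))
  in w ,
     decidable-stable (unsorted? w) (λ ¬uns → ¬asc (subst Ascending (sym α≡)
       (¬unsorted⇒ascending w ¬uns (m≤m+n _ _)))) ,
     ( trans (cong (_+ length β) (trans (sym (length-shuffle w c _)) (cong length (sym α≡))))
             (trans (sym (length-++ α)) (↭range⇒length p))
     , z<s
     , subst (λ k → β ↭ range (c + k) (length β)) (sym z) β↭
     , avoiding-⊆ (Sub.++⁺ˡ α (skip D ⊆-refl)) av) ,
     α≡
  where
  D : ℕ
  D = c + n
  β A H : List ℕ
  β = y ∷ β′
  A = filter (_<? y) α
  H = filter (∁? (_<? y)) α

  unique : Unique (α ++ β)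
  unique = ↭range⇒unique p

  <D : ∀ {x} → x ∈ α ++ β → x < D
  <D x∈ = proj₂ (All.lookup (↭range⇒inside p) x∈)

  -- The letters u, v, D, b would form 2143 if b exceeded u, and 3241 if b were less than v.
  straddle : ∀ {u v} → u ∷ v ∷ [] ⊆ α → v < u → ∀ {b} → b ∈ β → v < b × b < u
  straddle {u} {v} τ v<u {b} b∈ = v<b , b<u
    where
    quad : u ∷ v ∷ D ∷ b ∷ [] ⊆ α ++ D ∷ β
    quad = Sub.++⁺ τ (refl ∷ from∈ b∈)
    b<D = <D (∈-++⁺ʳ α b∈)
    u<D = <D (∈-++⁺ˡ (to∈ τ))
    b<u : b < u
    b<u with <-cmp b u
    ... | tri< b<u _ _  = b<u
    ... | tri≈ _ refl _ = contradiction refl (unique-cross unique (to∈ τ) b∈)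
    ... | tri> _ _ u<b  = contradiction (like-2143 v<u u<b b<D) (av quad)
    v<b : v < b
    v<b with <-cmp v b
    ... | tri< v<b _ _  = v<b
    ... | tri≈ _ refl _ = contradiction refl (unique-cross unique (to∈ (∷ˡ⁻ τ)) b∈)
    ... | tri> _ _ b<v  = contradiction (like-3241 b<v v<u u<D) (av quad)

  -- One descent u, v of α is fixed. With the end it is compared to, x either forms a descent, which
  -- has β between its ends, or lies beyond that end in value, hence on the same side of β.
  zone : ∀ {x} → x ∈ α → (∀ {b} → b ∈ β → x < b) ⊎ (∀ {b} → b ∈ β → b < x)
  zone {x} x∈ = let u , v , τ , u≮v = ¬AllPairs⇒pair _<?_ ¬asc in by-position τ u≮v (⊆-pair τ x∈)
    where
    by-position : ∀ {u v} → u ∷ v ∷ [] ⊆ α → ¬ u < v → x ∷ v ∷ [] ⊆ α ⊎ u ∷ x ∷ [] ⊆ α →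
      (∀ {b} → b ∈ β → x < b) ⊎ (∀ {b} → b ∈ β → b < x)
    by-position {u} {v} τ u≮v = go
      where
      v<u : v < u
      v<u = ≤∧≢⇒< (≮⇒≥ u≮v) (λ v≡u → AllPairs-lookup unique (Sub.++⁺ʳ β τ) (sym v≡u))
      go : x ∷ v ∷ [] ⊆ α ⊎ u ∷ x ∷ [] ⊆ α →
        (∀ {b} → b ∈ β → x < b) ⊎ (∀ {b} → b ∈ β → b < x)
      go (inj₁ σ) with v <? x
      ... | yes v<x = inj₂ λ b∈ → proj₂ (straddle σ v<x b∈)
      ... | no  v≮x = inj₁ λ b∈ → ≤-<-trans (≮⇒≥ v≮x) (proj₁ (straddle τ v<u b∈))
      go (inj₂ σ) with x <? u
      ... | yes x<u = inj₁ λ b∈ → proj₁ (straddle σ x<u b∈)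
      ... | no  x≮u = inj₂ λ b∈ → <-≤-trans (proj₂ (straddle τ v<u b∈)) (≮⇒≥ x≮u)

  A⁻ : ∀ {x} → x ∈ A → x ∈ α × x < y
  A⁻ = ∈-filter⁻ (_<? y)
  H⁻ : ∀ {x} → x ∈ H → x ∈ α × ¬ x < y
  H⁻ = ∈-filter⁻ (∁? (_<? y))

  A<β : ∀ {x b} → x ∈ A → b ∈ β → x < b
  A<β x∈ b∈ with zone (proj₁ (A⁻ x∈))
  ... | inj₁ x<   = x< b∈
  ... | inj₂ y<x = contradiction (proj₂ (A⁻ x∈)) (<-asym (y<x (here refl)))

  β<H : ∀ {b x} → b ∈ β → x ∈ H → b < x
  β<H b∈ x∈ with zone (proj₁ (H⁻ x∈))
  ... | inj₁ x<y = contradiction (x<y (here refl)) (proj₂ (H⁻ x∈))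
  ... | inj₂ <x  = <x b∈

  A-ascending : Ascending A
  A-ascending = unique∧¬descent⇒ascending (AllPairs-resp-⊆ (Sub.++⁺ʳ β A⊆α) unique)
    λ τ s<r → <-asym (proj₂ (straddle (⊆-trans τ A⊆α) s<r (here refl))) (proj₂ (A⁻ (to∈ τ)))
    where
    A⊆α = filter-⊆ (_<? y) α

  H-ascending : Ascending H
  H-ascending = unique∧¬descent⇒ascending (AllPairs-resp-⊆ (Sub.++⁺ʳ β H⊆α) unique)
    λ τ s<r → proj₂ (H⁻ (to∈ (∷ˡ⁻ τ))) (proj₁ (straddle (⊆-trans τ H⊆α) s<r (here refl)))
    where
    H⊆α = filter-⊆ (∁? (_<? y)) α

  regroup : A ++ (β ++ H) ↭ range c n
  regroup = begin
    A ++ (β ++ H)   ↭⟨ ++⁺ˡ A (++-comm β H) ⟩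
    A ++ (H ++ β)   ≡⟨ ++-assoc A H β ⟨
    (A ++ H) ++ β   ↭⟨ ++⁺ʳ β (filter-↭-filter (_<? y) α) ⟨
    α ++ β          ↭⟨ p ⟩
    range c n       ∎
    where open PermutationReasoning

  first-split = range-split n {A} {β ++ H}
    (λ x∈ z∈ → [ A<β x∈ , (λ z∈H → <-trans (A<β x∈ (here refl)) (β<H (here refl) z∈H)) ]
               (∈-++⁻ β z∈))
    regroup
  second-split = range-split (length (β ++ H)) {β} {H} β<H (proj₂ first-split)
  A↭ = proj₁ first-split
  β↭ = proj₁ second-split
  H↭ = proj₂ second-split

avoider-cases : ∀ {c n π} → Avoider c (suc n) π →
  (∃[ α ] Avoider c n α × π ≡ α ∷ʳ (c + n)) ⊎
  (∃[ code ] (Unsorted (proj₁ code) × ValidShuffled c n code) × π ≡ shuffled c (c + n) code) ⊎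
  (∃[ code ] ValidLayered c n code × π ≡ layered c (c + n) code)
avoider-cases {c} {n} {π} (p , av)
  with α , β , refl ← ∈-∃++ (∈-resp-↭ (↭-sym p)
         (subst (c + n ∈_) (sym (range-∷ʳ c n)) (∈-++⁺ʳ (range c n) (here refl))))
  with β | delete-max α p
... | [] | q =
  inj₁ (α , (↭-trans (↭-reflexive (sym (++-identityʳ α))) q ,
             avoiding-⊆ (Sub.++⁺ʳ _ ⊆-refl) av) , refl)
... | y ∷ β | q with AllPairs.allPairs? _<?_ α
...   | no ¬asc =
  let w , uns , valid , α≡ = shuffled-complete α ¬asc q av
  in inj₂ (inj₁ ((w , y ∷ β) , (uns , valid) , cong (_++ c + n ∷ y ∷ β) α≡))
...   | yes asc =
  let w , X , valid , α≡ , β≡ = layered-complete α asc q z<s ≤-refl av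
  in inj₂ (inj₂ ((w , X) , valid , cong₂ (λ α β → α ++ c + n ∷ β) α≡ β≡))

-- From permutations as vectors to avoiders as lists

∈-range⁺ : ∀ {c n x} → c ≤ x → x < c + n → x ∈ range c n
∈-range⁺ {c} {zero}  c≤x x< = contradiction (subst (_ <_) (+-identityʳ c) x<) (≤⇒≯ c≤x)
∈-range⁺ {c} {suc n} {x} c≤x x< with c ≟ x
... | yes refl = here refl
... | no c≢x   = there (∈-range⁺ (≤∧≢⇒< c≤x c≢x) (subst (x <_) (+-suc c n) x<))

positive⇒suc : ∀ {n k} {ι : Vec (Fin (suc n)) k} → VecAll.All (zero {n} Fin.<_) ι →
  ∃[ κ ] ι ≡ Vec.map suc κ
positive⇒suc []                       = [] , refl
positive⇒suc {ι = suc i ∷ _} (_ ∷ ps) with κ , refl ← positive⇒suc ps = i ∷ κ , refl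

increasing-map-suc⁻ : ∀ {n k} (ι : Vec (Fin n) k) → Increasing (Vec.map suc ι) → Increasing ι
increasing-map-suc⁻ []      []        = []
increasing-map-suc⁻ (_ ∷ ι) (i< ∷ ps) = VecAll.map s<s⁻¹ (VecAll.map⁻ i<) ∷ increasing-map-suc⁻ ι ps

module _ {A : Set} where

  -- With its converse below, this exchanges the increasing position vectors of `Contains` for the
  -- sublists of `Avoiding`.
  increasing⇒⊆ : ∀ {n k} (f : Fin n → A) (ι : Vec (Fin n) k) → Increasing ι →
    toList (Vec.map f ι) ⊆ tabulate f
  increasing⇒⊆ f [] _ = minimum _
  increasing⇒⊆ {suc n} f (zero ∷ ι) (pos ∷ inc) with κ , refl ← positive⇒suc pos =
    refl ∷ subst (λ v → toList v ⊆ tabulate (f ∘ suc)) (Vec.map-∘ f suc κ)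
      (increasing⇒⊆ (f ∘ suc) κ (increasing-map-suc⁻ κ inc))
  increasing⇒⊆ {suc n} f (suc i ∷ ι) (i< ∷ inc)
    with κ , refl ← positive⇒suc (VecAll.map (m<n⇒0<n {suc (toℕ i)}) i<) =
    skip _ (subst (λ v → toList v ⊆ tabulate (f ∘ suc)) (Vec.map-∘ f suc (i ∷ κ))
      (increasing⇒⊆ (f ∘ suc) (i ∷ κ) (increasing-map-suc⁻ (i ∷ κ) (i< ∷ inc))))

  ⊆⇒increasing : ∀ {n} (f : Fin n → A) {xs} → xs ⊆ tabulate f →
    ∃[ ι ] Increasing {length xs} ι × toList (Vec.map f ι) ≡ xs
  ⊆⇒increasing {zero} f [] = [] , [] , refl
  ⊆⇒increasing {suc n} f (skip _ τ) with ι , inc , eq ← ⊆⇒increasing (f ∘ suc) τ =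
    Vec.map suc ι , VecPairs.map⁺ (VecPairs.map s<s inc) ,
    trans (cong toList (sym (Vec.map-∘ f suc ι))) eq
  ⊆⇒increasing {suc n} f (refl ∷ τ) with ι , inc , eq ← ⊆⇒increasing (f ∘ suc) τ =
    zero ∷ Vec.map suc ι ,
    VecAll.map⁺ (VecAll.universal (λ _ → z<s) ι) ∷ VecPairs.map⁺ (VecPairs.map s<s inc) ,
    cong (f zero ∷_) (trans (cong toList (sym (Vec.map-∘ f suc ι))) eq)

-- σ is the inverse of v, so that the last hypothesis lists the letters of u by
-- increasing rank in v.
order-isomorphic : ∀ {k n} (u : Word k n) (v : Word k k) (σ : Vec (Fin k) k)
  {_ : True (Fin.all? λ i → lookup σ (lookup v i) Fin.≟ i)} →
  Linked Fin._<_ (Vec.map (lookup u) σ) → OrderIsomorphic u v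
order-isomorphic u v σ {σ∘v} sorted i j = mk⇔ reflects (preserves i j)
  where
  inverse : ∀ i → lookup σ (lookup v i) ≡ i
  inverse = toWitness σ∘v
  preserves : ∀ i j → lookup v i Fin.< lookup v j → lookup u i Fin.< lookup u j
  preserves i j vi<vj = subst₂ Fin._<_ (letter i) (letter j)
    (Linked.lookup⁺ Fin.<-trans sorted vi<vj)
    where
    letter : ∀ i → lookup (Vec.map (lookup u) σ) (lookup v i) ≡ lookup u i
    letter i = trans (Vec.lookup-map (lookup v i) (lookup u) σ) (cong (lookup u) (inverse i))
  reflects : lookup u i Fin.< lookup u j → lookup v i Fin.< lookup v j
  reflects ui<uj with Fin.<-cmp (lookup v i) (lookup v j)
  ... | tri< vi<vj _ _ = vi<vj
  ... | tri≈ _ vi≡vj _ = contradiction ui<uj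
    (Fin.<-irrefl (cong (lookup u)
      (trans (sym (inverse i)) (trans (cong (lookup σ) vi≡vj) (inverse j)))))
  ... | tri> _ _ vj<vi = contradiction ui<uj (Fin.<-asym (preserves j i vj<vi))

embed : ∀ {k n} → ℕ → Word k n → List ℕ
embed c w = tabulate (λ i → c + toℕ (lookup w i))

embed-injective : ∀ {k n c} {u v : Word k n} → embed c u ≡ embed c v → u ≡ v
embed-injective {u = []}    {[]}    _  = refl
embed-injective {c = c} {u = _ ∷ _} {_ ∷ _} eq with eq₁ , eq₂ ← ∷-injective eq =
  cong₂ _∷_ (Fin.toℕ-injective (+-cancelˡ-≡ c _ _ eq₁)) (embed-injective eq₂)

embed-surjective : ∀ {c n} k {xs} → length xs ≡ k → All (Inside c (c + n)) xs →
  ∃[ w ] xs ≡ embed {k} {n} c w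
embed-surjective zero    {[]}     refl []                = [] , refl
embed-surjective {c} {n} (suc k) {x ∷ xs} len ((c≤x , x<) ∷ ins)
  with w , refl ← embed-surjective k (suc-injective len) ins =
  fromℕ< x∸c<n ∷ w ,
  cong (_∷ embed c w) (sym (trans (cong (c +_) (Fin.toℕ-fromℕ< x∸c<n)) (m+[n∸m]≡n c≤x)))
  where
  x∸c<n : x ∸ c < n
  x∸c<n = subst (x ∸ c <_) (m+n∸m≡n c n) (∸-monoˡ-< x< c≤x)

module _ {n : ℕ} (c : ℕ) (w : Word n n) where

  private
    letter : Fin n → ℕ
    letter i = c + toℕ (lookup w i)

    letter-mono : ∀ {i j} → lookup w i Fin.< lookup w j → letter i < letter j
    letter-mono = +-monoʳ-< c

    letter-mono⁻ : ∀ {i j} → letter i < letter j → lookup w i Fin.< lookup w j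
    letter-mono⁻ = +-cancelˡ-< c _ _

  -- Both lists are free of repetitions, by injectivity, and have the same members, by surjectivity.
  permutation⇒↭range : IsPermutation w → embed c w ↭ range c n
  permutation⇒↭range (injective , surjective) = ∼bag⇒↭ (unique∧set⇒bag
    (Unique.tabulate⁺ (λ eq → injective (Fin.toℕ-injective (+-cancelˡ-≡ c _ _ eq))))
    (AllPairs.map <⇒≢ (range-ascending c n))
    (mk⇔ to from))
    where
    to : ∀ {x} → x ∈ embed c w → x ∈ range c n
    to x∈ with i , refl ← ∈-tabulate⁻ x∈ =
      ∈-range⁺ (m≤m+n c _) (+-monoʳ-< c (Fin.toℕ<n (lookup w i)))
    from : ∀ {x} → x ∈ range c n → x ∈ embed c w
    from {x} x∈ with c≤x , x< ← All.lookup (range-inside c n) x∈ =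
      subst (_∈ embed c w) (trans (cong (λ j → c + toℕ j) (proj₂ (surjective j) refl))
          (trans (cong (c +_) (Fin.toℕ-fromℕ< x∸c<n)) (m+[n∸m]≡n c≤x)))
        (∈-tabulate⁺ (proj₁ (surjective j)))
      where
      x∸c<n : x ∸ c < n
      x∸c<n = subst (x ∸ c <_) (m+n∸m≡n c n) (∸-monoˡ-< x< c≤x)
      j : Fin n
      j = fromℕ< x∸c<n

  ↭range⇒permutation : embed c w ↭ range c n → IsPermutation w
  ↭range⇒permutation p = injective , surjective
    where
    distinct : ∀ {i j} → i Fin.< j → letter i ≢ letter j
    distinct i<j = AllPairs-lookup (↭range⇒unique p)
      (increasing⇒⊆ letter (_ ∷ _ ∷ []) ((i<j ∷ []) ∷ [] ∷ []))
    injective : ∀ {i j} → lookup w i ≡ lookup w j → i ≡ j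
    injective {i} {j} eq with Fin.<-cmp i j
    ... | tri< i<j _ _ = contradiction (cong (λ k → c + toℕ k) eq) (distinct i<j)
    ... | tri≈ _ i≡j _ = i≡j
    ... | tri> _ _ j<i = contradiction (cong (λ k → c + toℕ k) (sym eq)) (distinct j<i)
    surjective : ∀ j → ∃[ i ] (∀ {z} → z ≡ i → lookup w z ≡ j)
    surjective j =
      let i , eq = ∈-tabulate⁻ (∈-resp-↭ (↭-sym p)
                     (∈-range⁺ (m≤m+n c _) (+-monoʳ-< c (Fin.toℕ<n j))))
      in i , λ { refl → sym (Fin.toℕ-injective (+-cancelˡ-≡ c _ _ eq)) }

  avoids⇒avoiding : All (Avoids w) T → Avoiding (embed c w)
  avoids⇒avoiding (av₁ ∷ av₂ ∷ av₃ ∷ []) τ bad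
    with ι@(i ∷ j ∷ k ∷ l ∷ []) , inc , refl ← ⊆⇒increasing letter τ
    with bad
  ... | like-2143 q<p p<s s<r = av₁ (ι , inc , order-isomorphic (Vec.map (lookup w) ι)
    (1F ∷ 0F ∷ 3F ∷ 2F ∷ []) (1F ∷ 0F ∷ 3F ∷ 2F ∷ [])
    (letter-mono⁻ q<p ∷ letter-mono⁻ p<s ∷ letter-mono⁻ s<r ∷ [-]))
  ... | like-2431 s<p p<r r<q = av₂ (ι , inc , order-isomorphic (Vec.map (lookup w) ι)
    (1F ∷ 3F ∷ 2F ∷ 0F ∷ []) (3F ∷ 0F ∷ 2F ∷ 1F ∷ [])
    (letter-mono⁻ s<p ∷ letter-mono⁻ p<r ∷ letter-mono⁻ r<q ∷ [-]))
  ... | like-3241 s<q q<p p<r = av₃ (ι , inc , order-isomorphic (Vec.map (lookup w) ι)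
    (2F ∷ 1F ∷ 3F ∷ 0F ∷ []) (3F ∷ 1F ∷ 0F ∷ 2F ∷ [])
    (letter-mono⁻ s<q ∷ letter-mono⁻ q<p ∷ letter-mono⁻ p<r ∷ [-]))

  avoiding⇒avoids : Avoiding (embed c w) → All (Avoids w) T
  avoiding⇒avoids av =
    (λ { (ι@(_ ∷ _ ∷ _ ∷ _ ∷ []) , inc , iso) → av (increasing⇒⊆ letter ι inc) (like-2143
      (letter-mono (from (iso 1F 0F) z<s))
      (letter-mono (from (iso 0F 3F) (s<s z<s)))
      (letter-mono (from (iso 3F 2F) (s<s (s<s z<s))))) }) ∷
    (λ { (ι@(_ ∷ _ ∷ _ ∷ _ ∷ []) , inc , iso) → av (increasing⇒⊆ letter ι inc) (like-2431
      (letter-mono (from (iso 3F 0F) z<s))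
      (letter-mono (from (iso 0F 2F) (s<s z<s)))
      (letter-mono (from (iso 2F 1F) (s<s (s<s z<s))))) }) ∷
    (λ { (ι@(_ ∷ _ ∷ _ ∷ _ ∷ []) , inc , iso) → av (increasing⇒⊆ letter ι inc) (like-3241
      (letter-mono (from (iso 3F 1F) z<s))
      (letter-mono (from (iso 1F 0F) (s<s z<s)))
      (letter-mono (from (iso 0F 2F) (s<s (s<s z<s))))) }) ∷ []
    where open Equivalence using (from)

avoider? : ∀ {n} → Decidable (λ (π : Word n n) → IsPermutation π × All (Avoids π) T)
avoider? π = isPermutation? π ×-dec All.all? (avoids? π) T

opaque
  avoiders : ℕ → ℕ → List (List ℕ)
  avoiders c n = map (embed c) (S n T)

  avoiders-unique : ∀ c n → Unique (avoiders c n)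
  avoiders-unique c n = Unique.map⁺ embed-injective (Unique.filter⁺ avoider? (words-unique n n))

  ∈-avoiders⁻ : ∀ {c n π} → π ∈ avoiders c n → Avoider c n π
  ∈-avoiders⁻ {c} {n} π∈ =
    let w , w∈ , eq = ∈-map⁻ (embed c) π∈
        _ , perm , av = ∈-filter⁻ avoider? {xs = words n n} w∈
    in subst (Avoider c n) (sym eq) (permutation⇒↭range c w perm , avoids⇒avoiding c w av)

  ∈-avoiders⁺ : ∀ {c n π} → Avoider c n π → π ∈ avoiders c n
  ∈-avoiders⁺ {c} {n} (p , av) =
    let w , eq = embed-surjective n (↭range⇒length p) (↭range⇒inside p)
    in subst (_∈ avoiders c n) (sym eq) (∈-map⁺ (embed c) (∈-filter⁺ avoider? (words-complete w)
      ( ↭range⇒permutation c w (subst (_↭ range c n) eq p)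
      , avoiding⇒avoids c w (subst Avoiding eq av))))

  -- The number is independent of c, so a block contributes the same count wherever its interval
  -- begins.
  length-avoiders : ∀ c n → length (avoiders c n) ≡ length (S n T)
  length-avoiders c n = length-map (embed c) (S n T)

-- Distinct codes give distinct avoiders

split-at-max : ∀ {D : ℕ} {α β α′ β′} → All (_< D) α → All (_< D) α′ →
  α ++ D ∷ β ≡ α′ ++ D ∷ β′ → α ≡ α′ × β ≡ β′
split-at-max []        []        refl = refl , refl
split-at-max []        (D<D ∷ _) refl = contradiction D<D (<-irrefl refl)
split-at-max (D<D ∷ _) []        refl = contradiction D<D (<-irrefl refl)
split-at-max (_ ∷ α<)  (_ ∷ α′<) eq with refl , eq′ ← ∷-injective eq =
  let eqα , eqβ = split-at-max α< α′< eq′ in cong (_ ∷_) eqα , eqβ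

avoider-split : ∀ {c n α β α′ β′} (let D = c + n) →
  Avoider c (suc n) (α ++ D ∷ β) → Avoider c (suc n) (α′ ++ D ∷ β′) →
  α ++ D ∷ β ≡ α′ ++ D ∷ β′ → α ≡ α′ × β ≡ β′
avoider-split {α = α} {α′ = α′} av av′ = split-at-max (below α av) (below α′ av′)
  where
  below : ∀ {c n} α {β} → Avoider c (suc n) (α ++ c + n ∷ β) → All (_< c + n) α
  below α (p , _) = All.map proj₂ (All.++⁻ˡ α (↭range⇒inside (delete-max α p)))

unsorted⇒¬ascending : ∀ w {l h} → Unsorted w → l + zeros w ≤ h → ¬ Ascending (shuffle w l h)
unsorted⇒¬ascending (false ∷ w) {l} uns l≤ (_ ∷ asc) =
  unsorted⇒¬ascending w uns (≤-trans (≤-reflexive (sym (+-suc l (zeros w)))) l≤) asc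
unsorted⇒¬ascending (true ∷ w) {l} {h} ∈w l≤ (h< ∷ _) =
  <⇒≱ (All.lookup h< (low∈ w ∈w)) (m+n≤o⇒m≤o l l≤)
  where
  low∈ : ∀ w {l h} → false ∈ w → l ∈ shuffle w l h
  low∈ (false ∷ w) _          = here refl
  low∈ (true  ∷ w) (there ∈w) = there (low∈ w ∈w)

-- The bounds keep a low letter below every high one, so the first letter reveals the first bit.
shuffle-injective : ∀ w w′ {l h} → l + zeros w ≤ h → l + zeros w′ ≤ h →
  shuffle w l h ≡ shuffle w′ l h → w ≡ w′
shuffle-injective []          []           _  _   _  = refl
shuffle-injective []          (false ∷ w′) _  _   ()
shuffle-injective []          (true ∷ w′)  _  _   ()
shuffle-injective (false ∷ w) []           _  _   ()
shuffle-injective (true ∷ w)  []           _  _   ()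
shuffle-injective (false ∷ w) (false ∷ w′) {l} {h} l≤ l≤′ eq =
  cong (false ∷_) (shuffle-injective w w′
    (subst (_≤ h) (+-suc l _) l≤) (subst (_≤ h) (+-suc l _) l≤′) (∷-injectiveʳ eq))
shuffle-injective (true ∷ w)  (true ∷ w′)  l≤ l≤′ eq =
  cong (true ∷_) (shuffle-injective w w′ (m≤n⇒m≤1+n l≤) (m≤n⇒m≤1+n l≤′) (∷-injectiveʳ eq))
shuffle-injective (false ∷ w) (true ∷ w′)  l≤ _   eq =
  contradiction (∷-injectiveˡ eq) (<⇒≢ (<-≤-trans (m<m+n _ z<s) l≤))
shuffle-injective (true ∷ w)  (false ∷ w′) _  l≤′ eq =
  contradiction (sym (∷-injectiveˡ eq)) (<⇒≢ (<-≤-trans (m<m+n _ z<s) l≤′))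

-- Trailing false bits leave no trace in `lefts`; the equal lengths recover them.
lefts-injective : ∀ w w′ {b} → length w ≡ length w′ → lefts w b ≡ lefts w′ b → w ≡ w′
lefts-injective []          []           _   _  = refl
lefts-injective (false ∷ w) (false ∷ w′) len eq =
  cong (false ∷_) (lefts-injective w w′ (suc-injective len) eq)
lefts-injective (true ∷ w)  (true ∷ w′)  len eq =
  cong (true ∷_) (lefts-injective w w′ (suc-injective len) (∷-injectiveʳ eq))
lefts-injective (false ∷ w) (true ∷ w′)  {b} _ eq =
  contradiction (proj₁ (All.lookup (lefts-inside w (suc b))
    (subst (b ∈_) (sym eq) (here refl)))) 1+n≰n
lefts-injective (true ∷ w)  (false ∷ w′) {b} _ eq =
  contradiction (proj₁ (All.lookup (lefts-inside w′ (suc b)) (subst (b ∈_) eq (here refl)))) 1+n≰n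

++-cancel-length : ∀ {A : Set} (xs xs′ : List A) {ys ys′} → length xs ≡ length xs′ →
  xs ++ ys ≡ xs′ ++ ys′ → xs ≡ xs′
++-cancel-length []       []         _   _  = refl
++-cancel-length (x ∷ xs) (x′ ∷ xs′) len eq =
  cong₂ _∷_ (∷-injectiveˡ eq) (++-cancel-length xs xs′ (suc-injective len) (∷-injectiveʳ eq))

-- The first letter before the maximum is c for a false bit and c + |X| for a true one, which differ
-- because X is nonempty. The first true bit thereby reveals |X|, and with it the cut between X and
-- γ.
layers-injective : ∀ w w′ c X X′ → length w + length X ≡ length w′ + length X′ →
  0 < length X → 0 < length X′ →
  before w c (length X) ≡ before w′ c (length X′) →
  X ++ after w c (length X) ≡ X′ ++ after w′ c (length X′) → (w , X) ≡ (w′ , X′)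
layers-injective [] [] c X X′ _ _ _ _ eq =
  cong ([] ,_) (trans (sym (++-identityʳ X)) (trans eq (++-identityʳ X′)))
layers-injective [] (false ∷ w′) c X X′ _ _ _ () _
layers-injective [] (true ∷ w′) c X X′ _ _ _ () _
layers-injective (false ∷ w) [] c X X′ _ _ _ () _
layers-injective (true ∷ w) [] c X X′ _ _ _ () _
layers-injective (false ∷ w) (false ∷ w′) c X X′ len 0<X 0<X′ eq₁ eq₂ =
  cong (λ (w , X) → false ∷ w , X)
    (layers-injective w w′ (suc c) X X′ (suc-injective len) 0<X 0<X′ (∷-injectiveʳ eq₁) eq₂)
layers-injective (false ∷ w) (true ∷ w′) c X X′ _ _ 0<X′ eq₁ _ =
  contradiction (∷-injectiveˡ eq₁) (<⇒≢ (m<m+n c 0<X′))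
layers-injective (true ∷ w) (false ∷ w′) c X X′ _ 0<X _ eq₁ _ =
  contradiction (sym (∷-injectiveˡ eq₁)) (<⇒≢ (m<m+n c 0<X))
layers-injective (true ∷ w) (true ∷ w′) c X X′ len _ _ eq₁ eq₂
  with |X|≡ ← +-cancelˡ-≡ c _ _ (∷-injectiveˡ eq₁)
  with refl ← ++-cancel-length X X′ |X|≡ eq₂
  = cong (λ w → true ∷ w , X)
      (lefts-injective w w′ (suc-injective (+-cancelʳ-≡ (length X) _ _ len)) (∷-injectiveʳ eq₁))

private
  0≮length[] : ∀ {X : List ℕ} → [] ≡ X → ¬ 0 < length X
  0≮length[] refl ()

module _ {c n : ℕ} where

  -- The block is everything after the maximum. Its least value gives the number of false bits,
  -- hence the start of both runs.
  shuffled-injective : ∀ code code′ → ValidShuffled c n code → ValidShuffled c n code′ →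
    shuffled c (c + n) code ≡ shuffled c (c + n) code′ → code ≡ code′
  shuffled-injective code@(w , X) code′@(w′ , X′) v@(_ , 0<X , p , _) v′@(_ , _ , p′ , _) eq
    with eqα , refl ← avoider-split (shuffled-avoider code v) (shuffled-avoider code′ v′) eq
    = cong (_, X) (shuffle-injective w w′ (m≤m+n _ _)
        (≤-trans (≤-reflexive (sym z≡)) (m≤m+n _ _))
        (trans eqα (cong (λ e → shuffle w′ c (e + length X)) (sym z≡))))
    where
    nonempty : ∀ {X d d′} → 0 < length X → X ↭ range d (length X) → X ↭ range d′ (length X) → d ≤ d′
    nonempty {_ ∷ _} _ p p′ = min≤ p (min∈ p′)
    z≡ : c + zeros w ≡ c + zeros w′
    z≡ = ≤-antisym (nonempty 0<X p p′) (nonempty 0<X p′ p)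

  layered-injective : ∀ code code′ → ValidLayered c n code → ValidLayered c n code′ →
    layered c (c + n) code ≡ layered c (c + n) code′ → code ≡ code′
  layered-injective code@(w , X) code′@(w′ , X′) v@(len , 0<X , _) v′@(len′ , 0<X′ , _) eq =
    let eqα , eqβ = avoider-split (layered-avoider code v) (layered-avoider code′ v′) eq
    in layers-injective w w′ c X X′ (trans len (sym len′)) 0<X 0<X′ eqα eqβ

  ∷ʳ≢shuffled : ∀ {α} code → Avoider c n α → ValidShuffled c n code →
    α ∷ʳ (c + n) ≢ shuffled c (c + n) code
  ∷ʳ≢shuffled code av v@(_ , 0<X , _) eq =
    0≮length[] (proj₂ (avoider-split (∷ʳ-avoider av) (shuffled-avoider code v) eq)) 0<X

  ∷ʳ≢layered : ∀ {α} code → Avoider c n α → ValidLayered c n code →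
    α ∷ʳ (c + n) ≢ layered c (c + n) code
  ∷ʳ≢layered code@(_ , X) av v@(_ , 0<X , _) eq =
    0≮length[] (sym (++-conicalˡ X _
      (sym (proj₂ (avoider-split (∷ʳ-avoider av) (layered-avoider code v) eq))))) 0<X

  shuffled≢layered : ∀ code code′ → Unsorted (proj₁ code) → ValidShuffled c n code →
    ValidLayered c n code′ → shuffled c (c + n) code ≢ layered c (c + n) code′
  shuffled≢layered code@(w , X) code′@(w′ , X′) uns v v′ eq =
    unsorted⇒¬ascending w uns (m≤m+n _ _)
      (subst Ascending
        (sym (proj₁ (avoider-split (shuffled-avoider code v) (layered-avoider code′ v′) eq)))
        (before-ascending w′ c (length X′)))

-- Enumerating the codes

unique-map : ∀ {A B : Set} {f : A → B} {xs} → (∀ {x y} → x ∈ xs → y ∈ xs → f x ≡ f y → x ≡ y) →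
  Unique xs → Unique (map f xs)
unique-map inj []         = []
unique-map inj (x∉ ∷ uxs) =
  All.map⁺ (All.tabulate λ y∈ fx≡fy → All.lookup x∉ y∈ (inj (here refl) (there y∈) fx≡fy))
  ∷ unique-map (λ x∈ y∈ → inj (there x∈) (there y∈)) uxs

length-≡ : ∀ {A : Set} {xs ys : List A} → Unique xs → Unique ys →
  (∀ {x} → x ∈ xs → x ∈ ys) → (∀ {x} → x ∈ ys → x ∈ xs) → length xs ≡ length ys
length-≡ ux uy to from = ↭-length (∼bag⇒↭ (unique∧set⇒bag ux uy (mk⇔ to from)))

module _ {A B : Set} (f : A → List B) where

  pairs : List A → List (A × B)
  pairs = concatMap (λ x → map (x ,_) (f x))

  ∈-pairs⁺ : ∀ {x y xs} → x ∈ xs → y ∈ f x → (x , y) ∈ pairs xs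
  ∈-pairs⁺ x∈ y∈ = ∈-concatMap⁺ _ (Any.map (λ { refl → ∈-map⁺ _ y∈ }) x∈)

  ∈-pairs⁻ : ∀ {x y xs} → (x , y) ∈ pairs xs → x ∈ xs × y ∈ f x
  ∈-pairs⁻ {xs = xs} p∈ with x , x∈ , q ← find (∈-concatMap⁻ (λ x → map (x ,_) (f x)) {xs = xs} p∈)
    with y , y∈ , refl ← ∈-map⁻ _ q = x∈ , y∈

  pairs-unique : ∀ {xs} → Unique xs → (∀ x → Unique (f x)) → Unique (pairs xs)
  pairs-unique []                       _  = []
  pairs-unique {x ∷ xs} (x∉ ∷ uxs) uf = Unique.++⁺
    (Unique.map⁺ ,-injectiveʳ (uf x)) (pairs-unique uxs uf)
    λ (p∈ , q∈) → let _ , _ , eq = ∈-map⁻ _ p∈ in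
      All.lookup x∉ (subst (_∈ xs) (cong proj₁ eq) (proj₁ (∈-pairs⁻ q∈))) refl

  length-pairs : ∀ {m} xs → (∀ x → length (f x) ≡ m) → length (pairs xs) ≡ length xs ℕ.* m
  length-pairs []       _ = refl
  length-pairs (x ∷ xs) len = trans (length-++ (map (x ,_) (f x)))
    (cong₂ _+_ (trans (length-map (x ,_) (f x)) (len x)) (length-pairs xs len))

bitstrings : ℕ → List Bits
bitstrings zero    = [] ∷ []
bitstrings (suc k) = map (false ∷_) (bitstrings k) ++ map (true ∷_) (bitstrings k)

∈-bitstrings⁺ : ∀ w → w ∈ bitstrings (length w)
∈-bitstrings⁺ []          = here refl
∈-bitstrings⁺ (false ∷ w) = ∈-++⁺ˡ (∈-map⁺ (false ∷_) (∈-bitstrings⁺ w))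
∈-bitstrings⁺ (true  ∷ w) =
  ∈-++⁺ʳ (map (false ∷_) (bitstrings (length w))) (∈-map⁺ (true ∷_) (∈-bitstrings⁺ w))

∈-bitstrings⁻ : ∀ k {w} → w ∈ bitstrings k → length w ≡ k
∈-bitstrings⁻ zero    (here refl) = refl
∈-bitstrings⁻ (suc k) w∈ with ∈-++⁻ (map (false ∷_) (bitstrings k)) w∈
... | inj₁ p with _ , v∈ , refl ← ∈-map⁻ _ p = cong suc (∈-bitstrings⁻ k v∈)
... | inj₂ p with _ , v∈ , refl ← ∈-map⁻ _ p = cong suc (∈-bitstrings⁻ k v∈)

bitstrings-unique : ∀ k → Unique (bitstrings k)
bitstrings-unique zero    = [] ∷ []
bitstrings-unique (suc k) = Unique.++⁺
  (Unique.map⁺ ∷-injectiveʳ (bitstrings-unique k)) (Unique.map⁺ ∷-injectiveʳ (bitstrings-unique k))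
  λ (p , q) → let _ , _ , eq = ∈-map⁻ _ p ; _ , _ , eq′ = ∈-map⁻ _ q in
    contradiction (∷-injectiveˡ (trans (sym eq) eq′)) λ ()

-- Σ g (k + i) a (m − i) over i < m: the terms with m − i = 0 are left out, because
-- the block is nonempty.
convolve : (ℕ → ℕ) → (ℕ → ℕ) → ℕ → ℕ → ℕ
convolve a g k zero    = 0
convolve a g k (suc m) = g k ℕ.* a (suc m) + convolve a g (suc k) m

module _ {Q : Bits → Set} (Q? : Decidable Q) (start : Bits → ℕ) where

  -- These are the codes of total size k + m with at least k bits; each step moves one letter from
  -- the block to the bits.
  codes : ℕ → ℕ → List Code
  codes k zero    = []
  codes k (suc m) =
    pairs (λ w → avoiders (start w) (suc m)) (filter Q? (bitstrings k)) ++ codes (suc k) m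

  ∈-codes⁻ : ∀ k m {w X} → (w , X) ∈ codes k m → k ≤ length w × Q w × Valid start (k + m) (w , X)
  ∈-codes⁻ k (suc m) {w} {X} p with ∈-++⁻ (pairs _ (filter Q? (bitstrings k))) p
  ... | inj₁ q
    with w∈ , X∈ ← ∈-pairs⁻ (λ w → avoiders (start w) (suc m)) {xs = filter Q? (bitstrings k)} q
    with w∈′ , Qw ← ∈-filter⁻ Q? {xs = bitstrings k} w∈
    with refl ← ∈-bitstrings⁻ k w∈′
    with len ← ↭range⇒length (proj₁ (∈-avoiders⁻ X∈))
    = ≤-refl , Qw , cong (length w +_) len , subst (0 <_) (sym len) z<s ,
      subst (λ n → Avoider (start w) n X) (sym len) (∈-avoiders⁻ X∈)
  ... | inj₂ q with k<w , Qw , len , valid ← ∈-codes⁻ (suc k) m q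
    = <⇒≤ k<w , Qw , trans len (sym (+-suc k m)) , valid

  ∈-codes⁺ : ∀ k m {w X} → k ≤ length w → Q w → Valid start (k + m) (w , X) → (w , X) ∈ codes k m
  ∈-codes⁺ k zero {w} {X} k≤w _ (len , 0<X , _) = contradiction len
    (>⇒≢ (subst (_< length w + length X) (sym (+-identityʳ k))
      (<-≤-trans (m<m+n k 0<X) (+-monoˡ-≤ (length X) k≤w))))
  ∈-codes⁺ k (suc m) {w} {X} k≤w Qw v@(len , 0<X , av) with k ≟ length w
  ... | yes refl = ∈-++⁺ˡ (∈-pairs⁺ _ (∈-filter⁺ Q? (∈-bitstrings⁺ w) Qw)
          (∈-avoiders⁺ (subst (λ n → Avoider (start w) n X) (+-cancelˡ-≡ (length w) _ _ len) av)))
  ... | no k≢w   = ∈-++⁺ʳ (pairs _ (filter Q? (bitstrings k)))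
          (∈-codes⁺ (suc k) m (≤∧≢⇒< k≤w k≢w) Qw (trans len (+-suc k m) , 0<X , av))

  codes-unique : ∀ k m → Unique (codes k m)
  codes-unique k zero    = []
  codes-unique k (suc m) = Unique.++⁺
    (pairs-unique _ (Unique.filter⁺ Q? (bitstrings-unique k))
      (λ w → avoiders-unique (start w) (suc m)))
    (codes-unique (suc k) m)
    λ { {w , X} (p , q) → <⇒≢ (proj₁ (∈-codes⁻ (suc k) m q))
      (sym (∈-bitstrings⁻ k (proj₁ (∈-filter⁻ Q? {xs = bitstrings k}
        (proj₁ (∈-pairs⁻ (λ w → avoiders (start w) (suc m))
          {xs = filter Q? (bitstrings k)} p)))))) }

  length-codes : ∀ {a : ℕ → ℕ} → (∀ c n → length (avoiders c n) ≡ a n) →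
    ∀ k m → length (codes k m) ≡ convolve a (λ k → length (filter Q? (bitstrings k))) k m
  length-codes len k zero    = refl
  length-codes len k (suc m) = trans (length-++ (pairs _ (filter Q? (bitstrings k))))
    (cong₂ _+_ (length-pairs _ (filter Q? (bitstrings k)) (λ w → len (start w) (suc m)))
      (length-codes len (suc k) m))

-- The recurrence for the number of avoiders

module _ (c n : ℕ) where

  shuffledCodes layeredCodes : List Code
  shuffledCodes = codes unsorted? (λ w → c + zeros w) 0 n
  layeredCodes  = codes U? (λ w → start w c) 0 n

  enumeration : List (List ℕ)
  enumeration = map (_∷ʳ (c + n)) (avoiders c n)
    ++ (map (shuffled c (c + n)) shuffledCodes ++ map (layered c (c + n)) layeredCodes)

  private
    shuffled⁻ : ∀ {code} → code ∈ shuffledCodes → Unsorted (proj₁ code) × ValidShuffled c n code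
    shuffled⁻ p = proj₂ (∈-codes⁻ unsorted? (λ w → c + zeros w) 0 n p)
    layered⁻ : ∀ {code} → code ∈ layeredCodes → ValidLayered c n code
    layered⁻ p = proj₂ (proj₂ (∈-codes⁻ U? (λ w → start w c) 0 n p))

  enumeration-unique : Unique enumeration
  enumeration-unique = Unique.++⁺
    (Unique.map⁺ (λ {α} {α′} eq → ∷ʳ-injectiveˡ α α′ eq) (avoiders-unique c n))
    (Unique.++⁺
      (unique-map (λ p q → shuffled-injective _ _ (proj₂ (shuffled⁻ p)) (proj₂ (shuffled⁻ q)))
        (codes-unique unsorted? _ 0 n))
      (unique-map (λ p q → layered-injective _ _ (layered⁻ p) (layered⁻ q)) (codes-unique U? _ 0 n))
      λ (p , q) → let x , x∈ , eq = ∈-map⁻ _ p ; y , y∈ , eq′ = ∈-map⁻ _ q in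
        shuffled≢layered x y (proj₁ (shuffled⁻ x∈)) (proj₂ (shuffled⁻ x∈)) (layered⁻ y∈)
          (trans (sym eq) eq′))
    λ (p , q) → let α , α∈ , eq = ∈-map⁻ _ p in
      [ (λ q → let y , y∈ , eq′ = ∈-map⁻ _ q in
          ∷ʳ≢shuffled y (∈-avoiders⁻ α∈) (proj₂ (shuffled⁻ y∈)) (trans (sym eq) eq′))
      , (λ q → let y , y∈ , eq′ = ∈-map⁻ _ q in
          ∷ʳ≢layered y (∈-avoiders⁻ α∈) (layered⁻ y∈) (trans (sym eq) eq′))
      ] (∈-++⁻ (map (shuffled c (c + n)) shuffledCodes) q)

  ∈-enumeration⁻ : ∀ {π} → π ∈ enumeration → Avoider c (suc n) π
  ∈-enumeration⁻ π∈ with ∈-++⁻ (map (_∷ʳ (c + n)) (avoiders c n)) π∈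
  ... | inj₁ p with α , α∈ , refl ← ∈-map⁻ _ p = ∷ʳ-avoider (∈-avoiders⁻ α∈)
  ... | inj₂ p with ∈-++⁻ (map (shuffled c (c + n)) shuffledCodes) p
  ...   | inj₁ q with code , code∈ , refl ← ∈-map⁻ _ q =
    shuffled-avoider code (proj₂ (shuffled⁻ code∈))
  ...   | inj₂ q with code , code∈ , refl ← ∈-map⁻ _ q = layered-avoider code (layered⁻ code∈)

  ∈-enumeration⁺ : ∀ {π} → Avoider c (suc n) π → π ∈ enumeration
  ∈-enumeration⁺ av with avoider-cases av
  ... | inj₁ (α , av , refl) = ∈-++⁺ˡ (∈-map⁺ _ (∈-avoiders⁺ av))
  ... | inj₂ (inj₁ (code , (uns , valid) , refl)) = ∈-++⁺ʳ (map (_∷ʳ (c + n)) (avoiders c n))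
    (∈-++⁺ˡ (∈-map⁺ (shuffled c (c + n)) (∈-codes⁺ unsorted? _ 0 n z≤n uns valid)))
  ... | inj₂ (inj₂ (code , valid , refl)) = ∈-++⁺ʳ (map (_∷ʳ (c + n)) (avoiders c n))
    (∈-++⁺ʳ (map (shuffled c (c + n)) shuffledCodes)
      (∈-map⁺ (layered c (c + n)) (∈-codes⁺ U? _ 0 n z≤n tt valid)))

module _ {a : ℕ → ℕ} (length-avoiders : ∀ c n → length (avoiders c n) ≡ a n) where

  avoiders-recurrence : ∀ n → a (suc n) ≡ a n +
    (convolve a (λ k → length (filter unsorted? (bitstrings k))) 0 n
      + convolve a (λ k → length (filter U? (bitstrings k))) 0 n)
  avoiders-recurrence n = begin
    a (suc n)
      ≡⟨ length-avoiders 0 (suc n) ⟨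
    length (avoiders 0 (suc n))
      ≡⟨ length-≡ (avoiders-unique 0 (suc n)) (enumeration-unique 0 n)
           (λ p → ∈-enumeration⁺ 0 n (∈-avoiders⁻ p))
           (λ p → ∈-avoiders⁺ (∈-enumeration⁻ 0 n p)) ⟩
    length (map (_∷ʳ n) (avoiders 0 n) ++ (map (shuffled 0 n) sh ++ map (layered 0 n) la))
      ≡⟨ trans (length-++ (map (_∷ʳ n) (avoiders 0 n)))
               (cong (length (map (_∷ʳ n) (avoiders 0 n)) +_) (length-++ (map (shuffled 0 n) sh))) ⟩
    length (map (_∷ʳ n) (avoiders 0 n)) +
      (length (map (shuffled 0 n) sh) + length (map (layered 0 n) la))
      ≡⟨ cong₂ _+_ (length-map _ (avoiders 0 n)) (cong₂ _+_ (length-map _ sh) (length-map _ la)) ⟩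
    length (avoiders 0 n) + (length sh + length la)
      ≡⟨ cong₂ _+_ (length-avoiders 0 n)
           (cong₂ _+_ (length-codes unsorted? _ length-avoiders 0 n)
                      (length-codes U? _ length-avoiders 0 n)) ⟩
    _ ∎
    where
    open ≡-Reasoning
    sh la : List Code
    sh = shuffledCodes 0 n
    la = layeredCodes 0 n

-- Counting bit strings

length-filter-map : ∀ {A B : Set} {P : B → Set} (P? : Decidable P) (f : A → B) xs →
  length (filter P? (map f xs)) ≡ length (filter (λ x → P? (f x)) xs)
length-filter-map P? f []       = refl
length-filter-map P? f (x ∷ xs) with does (P? (f x))
... | true  = cong suc (length-filter-map P? f xs)
... | false = length-filter-map P? f xs

count : ∀ {Q : Bits → Set} → Decidable Q → ℕ → ℕ
count Q? k = length (filter Q? (bitstrings k))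

count-suc : ∀ {Q : Bits → Set} (Q? : Decidable Q) k →
  count Q? (suc k) ≡ count (λ w → Q? (false ∷ w)) k + count (λ w → Q? (true ∷ w)) k
count-suc Q? k =
  trans (cong length (filter-++ Q? (map (false ∷_) (bitstrings k)) _))
  (trans (length-++ (filter Q? (map (false ∷_) (bitstrings k))))
    (cong₂ _+_ (length-filter-map Q? (false ∷_) (bitstrings k))
               (length-filter-map Q? (true ∷_) (bitstrings k))))

count-all : ∀ {Q : Bits → Set} (Q? : Decidable Q) → (∀ w → Q w) → ∀ k → count Q? k ≡ 2 ^ k
count-all Q? all zero    = cong length (filter-all Q? (All.universal all ([] ∷ [])))
count-all Q? all (suc k) = trans (count-suc Q? k) (cong₂ _+_
  (count-all (λ w → Q? (false ∷ w)) (λ w → all (false ∷ w)) k)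
  (trans (count-all (λ w → Q? (true ∷ w)) (λ w → all (true ∷ w)) k) (sym (+-identityʳ (2 ^ k)))))

-- Only the string of true bits is missed.
count-false∈ : ∀ k → suc (count (false ∈?_) k) ≡ 2 ^ k
count-false∈ zero    = refl
count-false∈ (suc k) = begin
  suc (count (false ∈?_) (suc k))  ≡⟨ cong suc (count-suc (false ∈?_) k) ⟩
  suc (count (λ w → false ∈? (false ∷ w)) k + count (λ w → false ∈? (true ∷ w)) k)
    ≡⟨ cong suc (cong₂ _+_ (count-all (λ w → false ∈? (false ∷ w)) (λ _ → here refl) k)
         (cong length (filter-≐ (λ w → false ∈? (true ∷ w)) (false ∈?_)
           ((λ { (there p) → p }) , there) (bitstrings k)))) ⟩
  suc (2 ^ k + count (false ∈?_) k) ≡⟨ +-suc (2 ^ k) _ ⟨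
  2 ^ k + suc (count (false ∈?_) k)
    ≡⟨ cong (2 ^ k +_) (trans (count-false∈ k) (sym (+-identityʳ _))) ⟩
  2 ^ suc k ∎
  where open ≡-Reasoning

-- The k + 1 sorted strings are those with all false bits first. In the induction a leading true bit
-- leaves one sorted string, the one without false bits.
count-unsorted : ∀ k → count unsorted? k + suc k ≡ 2 ^ k
count-unsorted zero    = refl
count-unsorted (suc k) = begin
  count unsorted? (suc k) + suc (suc k)
    ≡⟨ cong (_+ suc (suc k)) (count-suc unsorted? k) ⟩
  count unsorted? k + count (false ∈?_) k + suc (suc k)
    ≡⟨ rearrange (count unsorted? k) (count (false ∈?_) k) k ⟩
  (count unsorted? k + suc k) + (suc (count (false ∈?_) k) + 0)
    ≡⟨ cong₂ _+_ (count-unsorted k) (cong (_+ 0) (count-false∈ k)) ⟩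
  2 ^ suc k ∎
  where
  open ≡-Reasoning
  rearrange : ∀ x y k → x + y + suc (suc k) ≡ (x + suc k) + (suc y + 0)
  rearrange = solve-∀

-- Closing the recurrence into a linear system

module _ (a : ℕ → ℕ) where

  convolve-cong : ∀ {f g} → (∀ k → f k ≡ g k) → ∀ k m → convolve a f k m ≡ convolve a g k m
  convolve-cong f≗g k zero    = refl
  convolve-cong f≗g k (suc m) =
    cong₂ _+_ (cong (ℕ._* a (suc m)) (f≗g k)) (convolve-cong f≗g (suc k) m)

  convolve-+ : ∀ f g k m → convolve a (λ k → f k + g k) k m ≡ convolve a f k m + convolve a g k m
  convolve-+ f g k zero    = refl
  convolve-+ f g k (suc m) = trans (cong ((f k + g k) ℕ.* a (suc m) +_) (convolve-+ f g (suc k) m))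
    (distribute (f k) (g k) (a (suc m)) (convolve a f (suc k) m) (convolve a g (suc k) m))
    where
    distribute : ∀ x y z u v → (x + y) ℕ.* z + (u + v) ≡ x ℕ.* z + u + (y ℕ.* z + v)
    distribute = solve-∀

  convolve-suc : ∀ g k m → convolve a g (suc k) m ≡ convolve a (g ∘ suc) k m
  convolve-suc g k zero    = refl
  convolve-suc g k (suc m) = cong (g (suc k) ℕ.* a (suc m) +_) (convolve-suc g (suc k) m)

  convolve-head : ∀ g m → convolve a g 0 (suc m) ≡ g 0 ℕ.* a (suc m) + convolve a (g ∘ suc) 0 m
  convolve-head g m = cong (g 0 ℕ.* a (suc m) +_) (convolve-suc g 0 m)

  -- With A the generating function of a, these have generating functions (A - a₀)/(1-2x), (A -
  -- a₀)/(1-x)² and (A - a₀)/(1-x). Shifting k doubles the weight 2ᵏ and adds 1 to the weight k + 1;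
  -- `totals` enters to account for that 1.
  powers ranks totals : ℕ → ℕ
  powers = convolve a (2 ^_) 0
  ranks  = convolve a suc 0
  totals = convolve a (λ _ → 1) 0

  powers-suc : ∀ m → powers (suc m) ≡ a (suc m) + (powers m + powers m)
  powers-suc m = trans (convolve-head (2 ^_) m) (cong₂ _+_ (+-identityʳ (a (suc m)))
    (trans (convolve-cong (λ k → cong (2 ^ k +_) (+-identityʳ (2 ^ k))) 0 m)
      (convolve-+ (2 ^_) (2 ^_) 0 m)))

  ranks-suc : ∀ m → ranks (suc m) ≡ a (suc m) + (totals m + ranks m)
  ranks-suc m = trans (convolve-head suc m) (cong₂ _+_ (+-identityʳ (a (suc m)))
    (convolve-+ (λ _ → 1) suc 0 m))

  totals-suc : ∀ m → totals (suc m) ≡ a (suc m) + totals m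
  totals-suc m = trans (convolve-head (λ _ → 1) m) (cong (_+ totals m) (+-identityʳ (a (suc m))))

∣S∣ : ℕ → ℕ
∣S∣ n = length (S n T)

-- The weights 2ᵏ - k - 1 and 2ᵏ of the two cases are added, with k + 1 moved to the left as `ranks`
-- to avoid subtraction.
∣S∣-suc : ∀ n → ∣S∣ (suc n) + ranks ∣S∣ n ≡ ∣S∣ n + (powers ∣S∣ n + powers ∣S∣ n)
∣S∣-suc n = begin
  ∣S∣ (suc n) + ranks ∣S∣ n
    ≡⟨ cong (_+ ranks ∣S∣ n) (avoiders-recurrence {∣S∣} length-avoiders n) ⟩
  ∣S∣ n + (convolve ∣S∣ (count unsorted?) 0 n + convolve ∣S∣ (count U?) 0 n) + ranks ∣S∣ n
    ≡⟨ rearrange (∣S∣ n) (convolve ∣S∣ (count unsorted?) 0 n) _ (ranks ∣S∣ n) ⟩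
  ∣S∣ n + ((convolve ∣S∣ (count unsorted?) 0 n + ranks ∣S∣ n) + convolve ∣S∣ (count U?) 0 n)
    ≡⟨ cong (∣S∣ n +_) (cong₂ _+_
         (trans (sym (convolve-+ ∣S∣ (count unsorted?) suc 0 n))
                (convolve-cong ∣S∣ count-unsorted 0 n))
         (convolve-cong ∣S∣ (count-all U? (λ _ → tt)) 0 n)) ⟩
  ∣S∣ n + (powers ∣S∣ n + powers ∣S∣ n) ∎
  where
  open ≡-Reasoning
  rearrange : ∀ w x y z → w + (x + y) + z ≡ w + ((x + z) + y)
  rearrange = solve-∀

-- The generating function

open import Data.Integer.Base as ℤ using (0ℤ; +_; -_)
import Data.Integer.Properties as ℤ
import Data.Integer.Tactic.RingSolver as ℤ

-- The product with the denominator unfolds to this sum.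
Recurrent : Series → Set
Recurrent C = ∀ n → C n ℤ.* + 2 ℤ.+ (C (1 + n) ℤ.* - + 9 ℤ.+ (C (2 + n) ℤ.* + 11 ℤ.+
                    (C (3 + n) ℤ.* - + 6 ℤ.+ C (4 + n) ℤ.* + 1))) ≡ 0ℤ

-- The vector of the four sequences evolves linearly; the recurrence of A is the
-- Cayley–Hamilton identity of the matrix.
module _ {A P Q R : Series}
  (A-suc : ∀ n → A (suc n) ≡ A n ℤ.+ (P n ℤ.+ P n) ℤ.- Q n)
  (P-suc : ∀ n → P (suc n) ≡ A (suc n) ℤ.+ (P n ℤ.+ P n))
  (Q-suc : ∀ n → Q (suc n) ≡ A (suc n) ℤ.+ (R n ℤ.+ Q n))
  (R-suc : ∀ n → R (suc n) ≡ A (suc n) ℤ.+ R n) where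

  linear-recurrence : Recurrent A
  linear-recurrence n
    -- Unfolding from the highest index down leaves only the four values at n.
    rewrite A-suc (3 + n) | P-suc (2 + n) | Q-suc (2 + n)
          | A-suc (2 + n) | P-suc (1 + n) | Q-suc (1 + n) | R-suc (1 + n)
          | A-suc (1 + n) | P-suc n | Q-suc n | R-suc n | A-suc n
    = cayley-hamilton (A n) (P n) (Q n) (R n)
    where
    cayley-hamilton : ∀ x p q r →
      let x₁ = x ℤ.+ (p ℤ.+ p) ℤ.- q
          p₁ = x₁ ℤ.+ (p ℤ.+ p) ; q₁ = x₁ ℤ.+ (r ℤ.+ q) ; r₁ = x₁ ℤ.+ r
          x₂ = x₁ ℤ.+ (p₁ ℤ.+ p₁) ℤ.- q₁
          p₂ = x₂ ℤ.+ (p₁ ℤ.+ p₁) ; q₂ = x₂ ℤ.+ (r₁ ℤ.+ q₁) ; r₂ = x₂ ℤ.+ r₁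
          x₃ = x₂ ℤ.+ (p₂ ℤ.+ p₂) ℤ.- q₂
          p₃ = x₃ ℤ.+ (p₂ ℤ.+ p₂) ; q₃ = x₃ ℤ.+ (r₂ ℤ.+ q₂)
          x₄ = x₃ ℤ.+ (p₃ ℤ.+ p₃) ℤ.- q₃
      in x ℤ.* + 2 ℤ.+ (x₁ ℤ.* - + 9 ℤ.+ (x₂ ℤ.* + 11 ℤ.+ (x₃ ℤ.* - + 6 ℤ.+ x₄ ℤ.* + 1))) ≡ 0ℤ
    cayley-hamilton = ℤ.solve-∀

F-suc : ∀ n → F T (suc n) ≡ F T n ℤ.+ (+ powers ∣S∣ n ℤ.+ + powers ∣S∣ n) ℤ.- + ranks ∣S∣ n
F-suc n = begin
  + ∣S∣ (suc n)
    ≡⟨ cancel (+ ∣S∣ (suc n)) (+ ranks ∣S∣ n) ⟩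
  + (∣S∣ (suc n) + ranks ∣S∣ n) ℤ.- + ranks ∣S∣ n
    ≡⟨ cong (λ m → + m ℤ.- + ranks ∣S∣ n) (∣S∣-suc n) ⟩
  + (∣S∣ n + (powers ∣S∣ n + powers ∣S∣ n)) ℤ.- + ranks ∣S∣ n ∎
  where
  open ≡-Reasoning
  cancel : ∀ x y → x ≡ x ℤ.+ y ℤ.- y
  cancel = ℤ.solve-∀

numerator denominator : Series
numerator   = poly (+ 1 ∷ - + 5 ∷ + 7 ∷ - + 4 ∷ [])
denominator = poly (+ 1 ∷ - + 6 ∷ + 11 ∷ - + 9 ∷ + 2 ∷ [])

-- The denominator has degree 4, so its product with C has the recurrence at 0 as coefficient 4.
-- Beyond that, the leading term of the Cauchy product is multiplied by 0 and the rest is the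
-- product for the shifted series.
*-denominator-vanishes : ∀ C → Recurrent C → ∀ n → (C * denominator) (4 + n) ≡ 0ℤ
*-denominator-vanishes C rec zero    = rec 0
*-denominator-vanishes C rec (suc n) =
  trans (cong₂ ℤ._+_ (ℤ.*-zeroʳ (C 0)) (*-denominator-vanishes (C ∘ suc) (rec ∘ suc) n)) refl

F*denominator : ∀ n → (F T * denominator) n ≡ numerator n
-- The recurrence governs only the coefficients from 4 on, where the numerator vanishes; the first
-- four are evaluated from the lists of avoiders.
F*denominator 0 = refl
F*denominator 1 = refl
F*denominator 2 = refl
F*denominator 3 = refl
F*denominator (suc (suc (suc (suc n)))) =
  *-denominator-vanishes (F T)
    (linear-recurrence {F T} {λ n → + powers ∣S∣ n} {λ n → + ranks ∣S∣ n} {λ n → + totals ∣S∣ n}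
      F-suc (λ n → cong +_ (powers-suc ∣S∣ n)) (λ n → cong +_ (ranks-suc ∣S∣ n))
      (λ n → cong +_ (totals-suc ∣S∣ n))) n

theorem25 : F T ≗ poly (+ 1 ∷ - + 5 ∷ + 7 ∷ - + 4 ∷ [])
    / poly (+ 1 ∷ - + 6 ∷ + 11 ∷ - + 9 ∷ + 2 ∷ [])
theorem25 = /-unique denominator (F T) F*denominator
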